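{- The category of MV-algebras with MV-algebra homomorphisms is dually equivalent to the full subcategory of the category of $\ominus$-spaces (and morphisms of $\ominus$-spaces) consisting of the MV-spaces.
   Context: **MV-algebras.** An MV-algebra is an algebra $(A,\oplus,\neg,0)$ of type $(2,1,0)$ such that, writing $1=\neg 0$: $(A,\oplus,0)$ is a commutative monoid; $\neg\neg a=a$; $a\oplus1=1$; and $\neg(\neg a\oplus b)\oplus b=\neg(\neg b\oplus a)\oplus a$ for all $a,b\in A$. **Priestley spaces.** A Priestley space is a compact ordered topological space $X$ such that whenever $x\not\leq y$ there is a clopen down-set $U$ with $y\in U$, $x\notin U$. If $\tau$ is the topology of $X$, then $\tau^\uparrow$ is the topology of $\tau$-open up-sets and $\tau^\downarrow$ is the topology of $\tau$-open down-sets. **$\ominus$-spaces.** A $\ominus$-space is a tuple $(X,i,+,\star)$ where: (1) $X$ is a Priestley space; (2) $i\colon X\to X$ is continuous and order-reversing; (3) $+$ is a partial binary function on $X$ with $\mathrm{dom}(+)=\{(x,y)\in X^2\mid y\leq i(x)\}$, which is upper continuous: continuous from $\mathrm{dom}(+)$, with the subspace topology of $(X,\tau^\uparrow)\times(X,\tau^\uparrow)$, to $(X,\tau^\uparrow)$; (4) $\star$ is a partial binary function on $X$ with $\mathrm{dom}(\star)=\{(x,y)\in X^2\mid i(x)\nleq y\}$, which is lower continuous: continuous from $\mathrm{dom}(\star)$, with the subspace topology of $(X,\tau^\downarrow)\times(X,\tau^\downarrow)$, to $(X,\tau^\downarrow)$; (5) $+$ and $\star$ are order-preserving in both coordinates (on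 their domains); (6) for any $(x,y)\in\mathrm{dom}(\star)$, $x\star y=\inf\{x+w\mid (x,w)\in\mathrm{dom}(+)\text{ and }w\nleq y\}$ (infimum in $X$); (7) for any $x\in X$, the map $L_x\colon w\mapsto x+w$ is a map ${\downarrow}i(x)\to{\uparrow}x$ (in particular $x\leq x+w$) with totally ordered image, and it has an upper adjoint $L_x^\sharp\colon{\uparrow}x\to{\downarrow}i(x)$, i.e. $L_x(w)\leq z\iff w\leq L_x^\sharp(z)$ for all $w\in{\downarrow}i(x)$, $z\in{\uparrow}x$. **Morphisms.** A morphism from a $\ominus$-space $(X_1,i_1,+_1,\star_1)$ to a $\ominus$-space $(X_2,i_2,+_2,\star_2)$ is a continuous order-preserving function $f\colon X_1\to X_2$ such that: (1) $f(i_1(x))=i_2(f(x))$ for all $x\in X_1$; (2) for all $x,y\in X_1$, if $(x,y)\in\mathrm{dom}(+_1)$ then $f(x)+_2f(y)\leq f(x+_1y)$; (3) for all $x\in X_1$, $z\in X_2$, if $(f(x),z)\in\mathrm{dom}(+_2)$ then there exists $w'\in X_1$ with $(x,w')\in\mathrm{dom}(+_1)$, $z\leq f(w')$, and $f(x+_1w')=f(x)+_2z$. **MV-spaces.** A $\ominus$-space $(X,i,+,\star)$ is an MV-space if for all $x,y,z\in X$: (i) $i(i(x))=x$; (ii) if $(x,y),(y,x)\in\mathrm{dom}(+)$, then $x+y=y+x$; (iii) if $(x,y+z),(y,z),(x+y,z),(x,y)\in\mathrm{dom}(+)$, then $x+(y+z)=(x+y)+z$; (iv) if $(i(x),y),(z,y)\in\mathrm{dom}(+)$,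 then $i(x)+y\leq i(z)$ if and only if $z+y\leq x$; (v) if $(x,y)\in\mathrm{dom}(\star)$ and there exists $w\nleq y$ such that $(z,w)\in\mathrm{dom}(+)$ and $z+w\leq x\star y$, then $z\leq x$. -}

module Defs where

open import Level using (Level; _⊔_) renaming (suc to lsuc)
open import Algebra.Bundles using (RawMonoid)
open import Algebra.Morphism.Structures using (module MonoidMorphisms)
import Algebra.Morphism.Construct.Composition as MorphismComposition
import Algebra.Morphism.Construct.Identity as MorphismIdentity
open import Algebra.Structures using (IsCommutativeMonoid)
open import Data.List.Base using (List)
open import Data.List.Relation.Unary.Any using (Any)
open import Data.Product.Base using (Σ; ∃; ∃₂; Σ-syntax; _×_; _,_; proj₁; proj₂)
open import Data.Product.Relation.Binary.Pointwise.NonDependent using (×-setoid)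
open import Data.Sum.Base using (_⊎_)
open import Data.Unit.Polymorphic.Base using (⊤)
open import Function.Base using (_∘_; _on_; flip)
open import Function.Bundles using (Func; _⟨$⟩_; _⇔_)
import Function.Construct.Composition as Composition
import Function.Construct.Identity as Identity
open import Relation.Binary.Bundles using (Poset; Setoid)
import Relation.Binary.Construct.On as On
open import Relation.Binary.Core using (Rel)
open import Relation.Binary.Definitions using (Adjoint; _Respects_)
open import Relation.Binary.Structures using (IsEquivalence)
open import Relation.Nullary.Negation.Core using (¬_)
open import Relation.Unary using (Pred; _∈_; _∉_; _⊆_; _≐_; _∩_; ∁; ⋃; _⊢_)

record Category o h e : Set (lsuc (o ⊔ h ⊔ e)) where
  infix  4 _≈_
  infixr 9 _∙_
  field
    Obj  : Set o
    Hom  : Obj → Obj → Set h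
    _≈_  : ∀ {A B} → Rel (Hom A B) e
    id   : ∀ {A} → Hom A A
    _∙_  : ∀ {A B C} → Hom B C → Hom A B → Hom A C
    isEquivalence : ∀ {A B} → IsEquivalence (_≈_ {A} {B})
    ∙-cong    : ∀ {A B C} {f f′ : Hom B C} {g g′ : Hom A B} →
                f ≈ f′ → g ≈ g′ → f ∙ g ≈ f′ ∙ g′
    identityˡ : ∀ {A B} (f : Hom A B) → id ∙ f ≈ f
    identityʳ : ∀ {A B} (f : Hom A B) → f ∙ id ≈ f
    assoc     : ∀ {A B C D} (f : Hom C D) (g : Hom B C) (h : Hom A B) →
                (f ∙ g) ∙ h ≈ f ∙ (g ∙ h)

  module Equiv {A B} = IsEquivalence (isEquivalence {A} {B})

infix 10 _ᵒᵖ

_ᵒᵖ : ∀ {o h e} → Category o h e → Category o h e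
C ᵒᵖ = record
  { Obj           = Obj
  ; Hom           = flip Hom
  ; _≈_           = _≈_
  ; id            = id
  ; _∙_           = flip _∙_
  ; isEquivalence = isEquivalence
  ; ∙-cong        = flip ∙-cong
  ; identityˡ     = identityʳ
  ; identityʳ     = identityˡ
  ; assoc         = λ f g h → Equiv.sym (assoc h g f)
  }
  where open Category C

FullSubcategory : ∀ {o h e p} (C : Category o h e) → Pred (Category.Obj C) p →
                  Category (o ⊔ p) h e
FullSubcategory C P = record
  { Obj           = Σ Obj P
  ; Hom           = Hom on proj₁
  ; _≈_           = _≈_
  ; id            = id
  ; _∙_           = _∙_
  ; isEquivalence = isEquivalence
  ; ∙-cong        = ∙-cong
  ; identityˡ     = identityˡ
  ; identityʳ     = identityʳ
  ; assoc         = assoc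
  }
  where open Category C

record Functor {o h e o′ h′ e′} (C : Category o h e) (D : Category o′ h′ e′) :
               Set (o ⊔ h ⊔ e ⊔ o′ ⊔ h′ ⊔ e′) where
  private
    module C = Category C
    module D = Category D
  field
    F₀     : C.Obj → D.Obj
    F₁     : ∀ {A B} → C.Hom A B → D.Hom (F₀ A) (F₀ B)
    F-cong : ∀ {A B} {f g : C.Hom A B} → f C.≈ g → F₁ f D.≈ F₁ g
    F-id   : ∀ {A} → F₁ (C.id {A}) D.≈ D.id
    F-∙    : ∀ {A B C} (f : C.Hom B C) (g : C.Hom A B) →
             F₁ (f C.∙ g) D.≈ F₁ f D.∙ F₁ g

idF : ∀ {o h e} (C : Category o h e) → Functor C C
idF C = record
  { F₀ = λ A → A ; F₁ = λ f → f ; F-cong = λ p → p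
  ; F-id = Equiv.refl ; F-∙ = λ _ _ → Equiv.refl }
  where open Category C

infixr 9 _∘F_

_∘F_ : ∀ {o h e o′ h′ e′ o″ h″ e″}
       {C : Category o h e} {D : Category o′ h′ e′} {E : Category o″ h″ e″} →
       Functor D E → Functor C D → Functor C E
_∘F_ {E = E} G F = record
  { F₀     = G.F₀ ∘ F.F₀
  ; F₁     = G.F₁ ∘ F.F₁
  ; F-cong = G.F-cong ∘ F.F-cong
  ; F-id   = Equiv.trans (G.F-cong F.F-id) G.F-id
  ; F-∙    = λ f g → Equiv.trans (G.F-cong (F.F-∙ f g)) (G.F-∙ (F.F₁ f) (F.F₁ g))
  }
  where
  module F = Functor F
  module G = Functor G
  open Category E

record NaturalIsomorphism {o h e o′ h′ e′} {C : Category o h e} {D : Category o′ h′ e′}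
                          (F G : Functor C D) : Set (o ⊔ h ⊔ h′ ⊔ e′) where
  private
    module C = Category C
    module F = Functor F
    module G = Functor G
  open Category D
  field
    η       : ∀ A → Hom (F.F₀ A) (G.F₀ A)
    natural : ∀ {A B} (f : C.Hom A B) → η B ∙ F.F₁ f ≈ G.F₁ f ∙ η A
    η⁻¹     : ∀ A → Hom (G.F₀ A) (F.F₀ A)
    isoˡ    : ∀ A → η⁻¹ A ∙ η A ≈ id
    isoʳ    : ∀ A → η A ∙ η⁻¹ A ≈ id

record Equivalence {o h e o′ h′ e′} (C : Category o h e) (D : Category o′ h′ e′) :
                   Set (o ⊔ h ⊔ e ⊔ o′ ⊔ h′ ⊔ e′) where
  field
    F    : Functor C D
    G    : Functor D C
    unit   : NaturalIsomorphism (idF C) (G ∘F F)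
    counit : NaturalIsomorphism (F ∘F G) (idF D)

DuallyEquivalent : ∀ {o h e o′ h′ e′} → Category o h e → Category o′ h′ e′ →
                   Set (o ⊔ h ⊔ e ⊔ o′ ⊔ h′ ⊔ e′)
DuallyEquivalent C D = Equivalence (C ᵒᵖ) D

record MVAlgebra ℓ : Set (lsuc ℓ) where
  infix  4 _≈_
  infixl 6 _⊕_
  infix  8 ~_
  field
    Carrier : Set ℓ
    _≈_     : Rel Carrier ℓ
    _⊕_     : Carrier → Carrier → Carrier
    ~_      : Carrier → Carrier
    0#      : Carrier

  1# : Carrier
  1# = ~ 0#

  field
    ⊕-isCommutativeMonoid : IsCommutativeMonoid _≈_ _⊕_ 0#
    ~-cong       : ∀ {a b} → a ≈ b → ~ a ≈ ~ b
    ~-involutive : ∀ a → ~ ~ a ≈ a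
    ⊕-zeroʳ      : ∀ a → a ⊕ 1# ≈ 1#
    łukasiewicz  : ∀ a b → ~ (~ a ⊕ b) ⊕ b ≈ ~ (~ b ⊕ a) ⊕ a

  open IsCommutativeMonoid ⊕-isCommutativeMonoid public

  rawMonoid : RawMonoid ℓ ℓ
  rawMonoid = record { Carrier = Carrier ; _≈_ = _≈_ ; _∙_ = _⊕_ ; ε = 0# }

record MVHom {ℓ} (A B : MVAlgebra ℓ) : Set ℓ where
  private
    module A = MVAlgebra A
    module B = MVAlgebra B
  open MonoidMorphisms A.rawMonoid B.rawMonoid using (IsMonoidHomomorphism)
  field
    ⟦_⟧                  : A.Carrier → B.Carrier
    isMonoidHomomorphism : IsMonoidHomomorphism ⟦_⟧
    ~-homo               : ∀ a → ⟦ A.~ a ⟧ B.≈ B.~ ⟦ a ⟧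

  open IsMonoidHomomorphism isMonoidHomomorphism public

MVAlgebras : ∀ ℓ → Category (lsuc ℓ) ℓ ℓ
MVAlgebras ℓ = record
  { Obj = MVAlgebra ℓ
  ; Hom = MVHom
  ; _≈_ = λ {A} {B} f g → ∀ a → MVAlgebra._≈_ B (⟦ f ⟧ a) (⟦ g ⟧ a)
  ; id  = λ {A} → record
      { ⟦_⟧ = λ a → a
      ; isMonoidHomomorphism =
          MorphismIdentity.isMonoidHomomorphism (MVAlgebra.rawMonoid A) (MVAlgebra.refl A)
      ; ~-homo = λ _ → MVAlgebra.refl A }
  ; _∙_ = λ {A} {B} {C} f g → record
      { ⟦_⟧ = ⟦ f ⟧ ∘ ⟦ g ⟧
      ; isMonoidHomomorphism = MorphismComposition.isMonoidHomomorphism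
          (MVAlgebra.trans C) (MVHom.isMonoidHomomorphism g) (MVHom.isMonoidHomomorphism f)
      ; ~-homo = λ a → MVAlgebra.trans C (MVHom.⟦⟧-cong f (MVHom.~-homo g a))
                                         (MVHom.~-homo f (⟦ g ⟧ a)) }
  ; isEquivalence = λ {A} {B} → record
      { refl  = λ _ → MVAlgebra.refl B
      ; sym   = λ p a → MVAlgebra.sym B (p a)
      ; trans = λ p q a → MVAlgebra.trans B (p a) (q a) }
  ; ∙-cong = λ {A} {B} {C} {f} {f′} {g} {g′} p q a →
      MVAlgebra.trans C (MVHom.⟦⟧-cong f (q a)) (p (⟦ g′ ⟧ a))
  ; identityˡ = λ {A} {B} _ _ → MVAlgebra.refl B
  ; identityʳ = λ {A} {B} _ _ → MVAlgebra.refl B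
  ; assoc     = λ {A} {B} {C} {D} _ _ _ _ → MVAlgebra.refl D
  }
  where open MVHom using (⟦_⟧)

-- Subsets of S are ℓ-valued predicates respecting _≈_, and unions (and, in
-- Compact, covers) are indexed by ℓ-small types.  Classically this loses
-- nothing: every predicate is equivalent to a Bool-valued one, so every
-- collection of subsets is indexed by a decidable part of Carrier → Bool.
-- The level m of proofs of openness is separate from ℓ because it grows when
-- forming products and subspaces.

record Topology {ℓ} (S : Setoid ℓ ℓ) m : Set (lsuc (ℓ ⊔ m)) where
  open Setoid S
  field
    IsOpen      : Pred (Pred Carrier ℓ) m
    isOpen-resp : ∀ {U V} → U ≐ V → U ∈ IsOpen → V ∈ IsOpen
    respects    : ∀ {U} → U ∈ IsOpen → U Respects _≈_
    whole       : (λ _ → ⊤) ∈ IsOpen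
    ∩-open      : ∀ {U V} → U ∈ IsOpen → V ∈ IsOpen → (U ∩ V) ∈ IsOpen
    ⋃-open      : ∀ {I : Set ℓ} {U : I → Pred Carrier ℓ} →
                  (∀ i → U i ∈ IsOpen) → ⋃ I U ∈ IsOpen

  IsClopen : Pred (Pred Carrier ℓ) m
  IsClopen U = U ∈ IsOpen × ∁ U ∈ IsOpen

module _ {ℓ : Level} {S T : Setoid ℓ ℓ} {m n : Level} where

  Continuous : Topology S m → Topology T n → Func S T → Set (lsuc ℓ ⊔ m ⊔ n)
  Continuous 𝒮 𝒯 f =
    ∀ {U} → U ∈ Topology.IsOpen 𝒯 → ((f ⟨$⟩_) ⊢ U) ∈ Topology.IsOpen 𝒮

  productTopology : Topology S m → Topology T n →
                    Topology (×-setoid S T) (lsuc ℓ ⊔ m ⊔ n)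
  productTopology 𝒮 𝒯 = record
    { IsOpen      = λ W → ∀ {x y} → W (x , y) → ∃₂ λ U V →
                      U ∈ S.IsOpen × V ∈ T.IsOpen × x ∈ U × y ∈ V ×
                      (∀ {x′ y′} → x′ ∈ U → y′ ∈ V → W (x′ , y′))
    ; isOpen-resp = λ (W⊆W′ , W′⊆W) oW w → let U , V , oU , oV , x∈U , y∈V , sub = oW (W′⊆W w) in
                      U , V , oU , oV , x∈U , y∈V , λ u v → W⊆W′ (sub u v)
    ; respects    = λ oW (p , q) w → let U , V , oU , oV , x∈U , y∈V , sub = oW w in
                      sub (S.respects oU p x∈U) (T.respects oV q y∈V)
    ; whole       = λ _ → _ , _ , S.whole , T.whole , _ , _ , _
    ; ∩-open      = λ oW oW′ (w , w′) →
                      let U  , V  , oU  , oV  , x∈U  , y∈V  , sub  = oW w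
                          U′ , V′ , oU′ , oV′ , x∈U′ , y∈V′ , sub′ = oW′ w′
                      in U ∩ U′ , V ∩ V′ , S.∩-open oU oU′ , T.∩-open oV oV′ ,
                         (x∈U , x∈U′) , (y∈V , y∈V′) ,
                         λ (u , u′) (v , v′) → sub u v , sub′ u′ v′
    ; ⋃-open      = λ oW (i , w) → let U , V , oU , oV , x∈U , y∈V , sub = oW i w in
                      U , V , oU , oV , x∈U , y∈V , λ u v → i , sub u v
    }
    where
    module S = Topology 𝒮
    module T = Topology 𝒯

subsetoid : ∀ {ℓ} (S : Setoid ℓ ℓ) → Pred (Setoid.Carrier S) ℓ → Setoid ℓ ℓ
subsetoid S D = On.setoid {B = ∃ D} S proj₁

subspaceTopology : ∀ {ℓ m} {S : Setoid ℓ ℓ} → Topology S m →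
                   (D : Pred (Setoid.Carrier S) ℓ) →
                   Topology (subsetoid S D) (lsuc ℓ ⊔ m)
subspaceTopology 𝒮 D = record
  { IsOpen      = λ W → ∃ λ U → U ∈ IsOpen × W ≐ (proj₁ ⊢ U)
  ; isOpen-resp = λ (W⊆W′ , W′⊆W) (U , oU , (W⊆U , U⊆W)) →
                    U , oU , (λ w → W⊆U (W′⊆W w)) , (λ u → W⊆W′ (U⊆W u))
  ; respects    = λ (U , oU , (W⊆U , U⊆W)) p w → U⊆W (respects oU p (W⊆U w))
  ; whole       = _ , whole , (λ _ → _) , (λ _ → _)
  ; ∩-open      = λ (U , oU , (W⊆U , U⊆W)) (U′ , oU′ , (W′⊆U′ , U′⊆W′)) →
                    U ∩ U′ , ∩-open oU oU′ ,
                    (λ (w , w′) → W⊆U w , W′⊆U′ w′) , (λ (u , u′) → U⊆W u , U′⊆W′ u′)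
  ; ⋃-open      = λ {I} o → ⋃ I (λ i → proj₁ (o i)) , ⋃-open (λ i → proj₁ (proj₂ (o i))) ,
                    (λ (i , w) → i , proj₁ (proj₂ (proj₂ (o i))) w) ,
                    (λ (i , u) → i , proj₂ (proj₂ (proj₂ (o i))) u)
  }
  where open Topology 𝒮

Compact : ∀ {ℓ m} {S : Setoid ℓ ℓ} → Topology S m → Set (lsuc ℓ ⊔ m)
Compact {ℓ} {S = S} 𝒮 =
  ∀ {I : Set ℓ} (U : I → Pred (Setoid.Carrier S) ℓ) →
  (∀ i → U i ∈ Topology.IsOpen 𝒮) → (∀ x → x ∈ ⋃ I U) →
  Σ[ is ∈ List I ] (∀ x → Any (λ i → x ∈ U i) is)

record PriestleySpace ℓ : Set (lsuc ℓ) where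
  field
    poset    : Poset ℓ ℓ ℓ

  open Poset poset public

  setoid : Setoid ℓ ℓ
  setoid = Eq.setoid

  IsDownSet : Pred (Pred Carrier ℓ) ℓ
  IsDownSet U = U Respects (flip _≤_)

  field
    τ         : Topology setoid ℓ

  open Topology τ public

  field
    compact   : Compact τ
    separated : ∀ {x y} → ¬ x ≤ y →
                Σ[ U ∈ Pred Carrier ℓ ] U ∈ IsClopen × U ∈ IsDownSet × y ∈ U × x ∉ U

  openSetsRespecting : Rel Carrier ℓ → Topology setoid ℓ
  openSetsRespecting R = record
    { IsOpen      = λ U → U ∈ IsOpen × U Respects R
    ; isOpen-resp = λ U≐V@(U⊆V , V⊆U) (oU , rU) →
                      isOpen-resp U≐V oU , λ p v → U⊆V (rU p (V⊆U v))
    ; respects    = λ (oU , _) → respects oU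
    ; whole       = whole , λ _ _ → _
    ; ∩-open      = λ (oU , rU) (oV , rV) →
                      ∩-open oU oV , λ p (u , v) → rU p u , rV p v
    ; ⋃-open      = λ o → ⋃-open (λ i → proj₁ (o i)) , λ p (i , u) → i , proj₂ (o i) p u
    }

  τ↑ : Topology setoid ℓ
  τ↑ = openSetsRespecting _≤_

  τ↓ : Topology setoid ℓ
  τ↓ = openSetsRespecting (flip _≤_)

  IsInfimum : Pred Carrier ℓ → Pred Carrier ℓ
  IsInfimum A m = (∀ {a} → a ∈ A → m ≤ a) × (∀ {b} → (∀ {a} → a ∈ A → b ≤ a) → b ≤ m)

record ⊖Space ℓ : Set (lsuc ℓ) where
  infix 6 _+_[_] _⋆_[_]

  field
    space        : PriestleySpace ℓ

  open PriestleySpace space public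

  field
    i-func       : Func setoid setoid
    i-continuous : Continuous τ τ i-func

  i : Carrier → Carrier
  i = i-func ⟨$⟩_

  dom+ : Pred (Carrier × Carrier) ℓ
  dom+ (x , y) = y ≤ i x

  dom⋆ : Pred (Carrier × Carrier) ℓ
  dom⋆ (x , y) = ¬ (i x ≤ y)

  -- Equality on a domain is that of X × X, so the values of + and ⋆ do not
  -- depend on the proof that a pair lies in the domain.

  field
    i-antitone   : ∀ {x y} → x ≤ y → i y ≤ i x
    +-func       : Func (subsetoid (×-setoid setoid setoid) dom+) setoid
    ⋆-func       : Func (subsetoid (×-setoid setoid setoid) dom⋆) setoid

  _+_[_] : ∀ x y → (x , y) ∈ dom+ → Carrier
  x + y [ p ] = +-func ⟨$⟩ ((x , y) , p)

  _⋆_[_] : ∀ x y → (x , y) ∈ dom⋆ → Carrier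
  x ⋆ y [ p ] = ⋆-func ⟨$⟩ ((x , y) , p)

  ↓_ : Carrier → Pred Carrier ℓ
  ↓ x = _≤ x

  ↑_ : Carrier → Pred Carrier ℓ
  ↑ x = x ≤_

  field
    +-continuous : Continuous (subspaceTopology (productTopology τ↑ τ↑) dom+) τ↑ +-func
    ⋆-continuous : Continuous (subspaceTopology (productTopology τ↓ τ↓) dom⋆) τ↓ ⋆-func

    +-monoˡ : ∀ {x x′ y} (p : (x , y) ∈ dom+) (p′ : (x′ , y) ∈ dom+) →
              x ≤ x′ → x + y [ p ] ≤ x′ + y [ p′ ]
    +-monoʳ : ∀ {x y y′} (p : (x , y) ∈ dom+) (p′ : (x , y′) ∈ dom+) →
              y ≤ y′ → x + y [ p ] ≤ x + y′ [ p′ ]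
    ⋆-monoˡ : ∀ {x x′ y} (p : (x , y) ∈ dom⋆) (p′ : (x′ , y) ∈ dom⋆) →
              x ≤ x′ → x ⋆ y [ p ] ≤ x′ ⋆ y [ p′ ]
    ⋆-monoʳ : ∀ {x y y′} (p : (x , y) ∈ dom⋆) (p′ : (x , y′) ∈ dom⋆) →
              y ≤ y′ → x ⋆ y [ p ] ≤ x ⋆ y′ [ p′ ]

    ⋆-infimum : ∀ {x y} (p : (x , y) ∈ dom⋆) →
                IsInfimum (λ v → ∃ λ w → Σ[ q ∈ (x , w) ∈ dom+ ] (¬ (w ≤ y) × v ≈ x + w [ q ]))
                          (x ⋆ y [ p ])

    +-increasing : ∀ {x w} (p : (x , w) ∈ dom+) → x ≤ x + w [ p ]

  L : ∀ x → ∃ (↓ i x) → ∃ (↑ x)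
  L x (w , p) = x + w [ p ] , +-increasing p

  field
    L-total : ∀ x (w w′ : ∃ (↓ i x)) →
              proj₁ (L x w) ≤ proj₁ (L x w′) ⊎ proj₁ (L x w′) ≤ proj₁ (L x w)
    L-adj   : ∀ x → Σ[ L♯ ∈ (∃ (↑ x) → ∃ (↓ i x)) ]
              Adjoint (_≤_ on proj₁) (_≤_ on proj₁) (L x) L♯

record ⊖Hom {ℓ} (X Y : ⊖Space ℓ) : Set (lsuc ℓ) where
  private
    module X = ⊖Space X
    module Y = ⊖Space Y
  field
    func       : Func X.setoid Y.setoid
    continuous : Continuous X.τ Y.τ func

  ⟦_⟧ : X.Carrier → Y.Carrier
  ⟦_⟧ = func ⟨$⟩_

  field
    mono   : ∀ {x y} → x X.≤ y → ⟦ x ⟧ Y.≤ ⟦ y ⟧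
    i-homo : ∀ x → ⟦ X.i x ⟧ Y.≈ Y.i ⟦ x ⟧

  dom+-preserving : ∀ {x y} → (x , y) ∈ X.dom+ → (⟦ x ⟧ , ⟦ y ⟧) ∈ Y.dom+
  dom+-preserving {x} p = Y.trans (mono p) (Y.reflexive (i-homo x))

  field
    +-lax  : ∀ {x y} (p : (x , y) ∈ X.dom+) →
             ⟦ x ⟧ Y.+ ⟦ y ⟧ [ dom+-preserving p ] Y.≤ ⟦ x X.+ y [ p ] ⟧
    +-lift : ∀ {x z} (q : (⟦ x ⟧ , z) ∈ Y.dom+) →
             ∃ λ w′ → Σ[ p ∈ (x , w′) ∈ X.dom+ ]
             (z Y.≤ ⟦ w′ ⟧ × ⟦ x X.+ w′ [ p ] ⟧ Y.≈ ⟦ x ⟧ Y.+ z [ q ])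

id-⊖Hom : ∀ {ℓ} {X : ⊖Space ℓ} → ⊖Hom X X
id-⊖Hom {X = X} = record
  { func       = Identity.function setoid
  ; continuous = λ o → o
  ; mono       = λ p → p
  ; i-homo     = λ _ → Eq.refl
  ; +-lax      = λ p → reflexive (Func.cong +-func (Eq.refl , Eq.refl))
  ; +-lift     = λ q → _ , q , refl , Eq.refl
  }
  where open ⊖Space X

infixr 9 _∘⊖_

_∘⊖_ : ∀ {ℓ} {X Y Z : ⊖Space ℓ} → ⊖Hom Y Z → ⊖Hom X Y → ⊖Hom X Z
_∘⊖_ {X = X} {Y} {Z} g f = record
  { func       = Composition.function f.func g.func
  ; continuous = λ o → f.continuous (g.continuous o)
  ; mono       = λ p → g.mono (f.mono p)
  ; i-homo     = λ x → Z.Eq.trans (Func.cong g.func (f.i-homo x)) (g.i-homo f.⟦ x ⟧)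
  ; +-lax      = λ p → Z.trans (Z.reflexive (Func.cong Z.+-func (Z.Eq.refl , Z.Eq.refl)))
                      (Z.trans (g.+-lax (f.dom+-preserving p)) (g.mono (f.+-lax p)))
  ; +-lift     = λ q →
      let w  , p  , z≤gw  , eq  = g.+-lift q
          w′ , p′ , w≤fw′ , eq′ = f.+-lift p
      in w′ , p′ , Z.trans z≤gw (g.mono w≤fw′) , Z.Eq.trans (Func.cong g.func eq′) eq
  }
  where
  module f = ⊖Hom f
  module g = ⊖Hom g
  module Y = ⊖Space Y
  module Z = ⊖Space Z

⊖Spaces : ∀ ℓ → Category (lsuc ℓ) (lsuc ℓ) ℓ
⊖Spaces ℓ = record
  { Obj = ⊖Space ℓ
  ; Hom = ⊖Hom
  ; _≈_ = λ {X} {Y} f g → ∀ x → ⊖Space._≈_ Y (⟦ f ⟧ x) (⟦ g ⟧ x)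
  ; id  = id-⊖Hom
  ; _∙_ = _∘⊖_
  ; isEquivalence = λ {X} {Y} → record
      { refl  = λ _ → ⊖Space.Eq.refl Y
      ; sym   = λ p x → ⊖Space.Eq.sym Y (p x)
      ; trans = λ p q x → ⊖Space.Eq.trans Y (p x) (q x) }
  ; ∙-cong = λ {X} {Y} {Z} {f} {f′} {g} {g′} p q x →
      ⊖Space.Eq.trans Z (Func.cong (⊖Hom.func f) (q x)) (p (⟦ g′ ⟧ x))
  ; identityˡ = λ {X} {Y} _ _ → ⊖Space.Eq.refl Y
  ; identityʳ = λ {X} {Y} _ _ → ⊖Space.Eq.refl Y
  ; assoc     = λ {X} {Y} {Z} {W} _ _ _ _ → ⊖Space.Eq.refl W
  }
  where open ⊖Hom using (⟦_⟧)

record IsMVSpace {ℓ} (X : ⊖Space ℓ) : Set ℓ where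
  open ⊖Space X
  field
    i-involutive : ∀ x → i (i x) ≈ x
    +-comm       : ∀ {x y} (p : (x , y) ∈ dom+) (q : (y , x) ∈ dom+) →
                   x + y [ p ] ≈ y + x [ q ]
    +-assoc      : ∀ {x y z} (yz : (y , z) ∈ dom+) (x[yz] : (x , y + z [ yz ]) ∈ dom+)
                   (xy : (x , y) ∈ dom+) ([xy]z : (x + y [ xy ] , z) ∈ dom+) →
                   x + (y + z [ yz ]) [ x[yz] ] ≈ (x + y [ xy ]) + z [ [xy]z ]
    +-i-swap     : ∀ {x y z} (p : (i x , y) ∈ dom+) (q : (z , y) ∈ dom+) →
                   (i x + y [ p ] ≤ i z) ⇔ (z + y [ q ] ≤ x)
    ⋆-reflect    : ∀ {x y z} (p : (x , y) ∈ dom⋆) →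
                   (∃ λ w → ¬ (w ≤ y) × Σ[ q ∈ (z , w) ∈ dom+ ] z + w [ q ] ≤ x ⋆ y [ p ]) →
                   z ≤ x

MVSpaces : ∀ ℓ → Category (lsuc ℓ) (lsuc ℓ) ℓ
MVSpaces ℓ = FullSubcategory (⊖Spaces ℓ) IsMVSpace

{-# OPTIONS --safe #-}
module Submission where

-- An MV-algebra A is sent to the space of its prime lattice ideals, ordered by inclusion, with
--   i x = { a | ¬ a ∉ x },  x + y = { c | c ⊖ b ∈ x for some b ∈ y },
--   x ⋆ y = { c | c ⊖ b ∈ x for all b ∉ y },
-- and an MV-space X to the algebra of its clopen down-sets, with ¬ U = { x | i x ∉ U } and
--   U ⊖ V = { x | x + z ∈ U for some z ≤ i x, z ∉ V }
--         = { x ∈ U | i x ≰ y and x ⋆ y ∈ U for all y ∈ V }.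
-- By compactness, upper continuity of + makes the first set closed and lower continuity of ⋆ makes
-- the second one open; they agree because x ⋆ y is the limit of the chain of all x + w with w ≰ y.
-- Dually, x ∉ U ⊕ V iff y + z ≤ x for some y ∉ U and z ∉ V, which turns conditions (i)–(iv) into the
-- monoid and negation axioms, while (v) gives (U ⊖ V) ⊕ V = U ∪ V and so the Łukasiewicz axiom.
-- The isomorphisms are those of Priestley duality.  Excluded middle for arbitrary types provides
-- choice, hence Tukey's lemma, from which the prime ideal theorem and compactness of the spectrum follow.

open import Axiom.ExcludedMiddle using (ExcludedMiddle)
open import Axiom.Extensionality.Propositional using (Extensionality)
open import Defs
open import Agda.Primitive using (Setω)
open import Algebra.Structures using (IsCommutativeMonoid)
open import Algebra.Structures.Biased using (isCommutativeMonoidˡ)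
open import Data.Bool.Base using (Bool; true; false)
open import Data.Empty using (⊥; ⊥-elim)
open import Data.List.Base using (List; []; _∷_; _++_; foldr)
open import Data.List.Membership.Propositional using () renaming (_∈_ to _∈ᴸ_)
open import Data.List.Relation.Binary.Subset.Propositional using () renaming (_⊆_ to _⊆ᴸ_)
import Data.List.Relation.Binary.Subset.Propositional.Properties as SubsetP
open import Data.List.Relation.Unary.All using (All; []; _∷_)
import Data.List.Relation.Unary.All as All
import Data.List.Relation.Unary.All.Properties as AllP
open import Data.List.Relation.Unary.Any using (Any; here; there)
import Data.List.Relation.Unary.Any.Properties as AnyP
open import Data.Maybe.Base using (Maybe; just; nothing)
open import Data.Product.Base using (∃; ∃₂; Σ-syntax; _×_; _,_; proj₁; proj₂)
open import Data.Sum.Base using (_⊎_; inj₁; inj₂; [_,_]′)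
import Data.Sum.Base as Sum
open import Data.Unit.Polymorphic.Base using (⊤)
open import Function.Bundles using (Func; mk⇔)
import Function.Bundles as Bundles
open import Level using (Level; _⊔_; Lift; lower) renaming (suc to lsuc)
open import Relation.Binary.Bundles using (Poset; Setoid)
open import Relation.Binary.Definitions using (_Respects_)
open import Relation.Binary.PropositionalEquality.Core using (_≡_; _≢_) renaming (refl to ≡-refl)
import Relation.Binary.Reasoning.Setoid as SetoidReasoning
open import Relation.Nullary.Decidable.Core using (Dec; yes; no; does)
open import Relation.Nullary.Negation.Core using (¬_; contradiction)
open import Relation.Unary using (Pred; _∈_; _∉_; _⊆_; _≐_; _∩_; _∪_; ∁; ⋃)

-- The algebra is neither assumed to be a chain nor embedded into a product of chains, so two
-- elements cannot simply be compared. The substitute is `prelinear`: an element below both `a ⊖ b`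
-- and `b ⊖ a` is zero. It gives `∧-⊖-distrib` and `⊖-interchange`, and through them the facts that
-- `sum`, `star`, `residual` and `adjoint` are prime ideals and that the sums with a fixed left
-- summand form a chain. Because of this, most prime ideals that have to exist are written down by
-- an explicit formula whose primality is checked directly. Maximality arguments enter only where no
-- formula is at hand: in separating two elements of the algebra and in proving the spectrum
-- compact.

-- Order and lattice arithmetic of MV-algebras

module MVOrder {ℓ} (A : MVAlgebra ℓ) where
  open MVAlgebra A
  open SetoidReasoning setoid

  infix  4 _≤_
  infixl 6 _⊖_
  infixr 5 _∨_
  infixr 5 _∧_

  _≤_ : Carrier → Carrier → Set ℓ
  a ≤ b = ~ a ⊕ b ≈ 1#

  _⊖_ _∨_ _∧_ : Carrier → Carrier → Carrier
  a ⊖ b = ~ (~ a ⊕ b)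
  a ∨ b = (a ⊖ b) ⊕ b
  a ∧ b = a ⊖ (a ⊖ b)

  ~1≈0 : ~ 1# ≈ 0#
  ~1≈0 = ~-involutive 0#

  ⊕-zeroˡ : ∀ a → 1# ⊕ a ≈ 1#
  ⊕-zeroˡ a = trans (comm 1# a) (⊕-zeroʳ a)

  ~1⊕ : ∀ a → ~ 1# ⊕ a ≈ a
  ~1⊕ a = trans (∙-congʳ ~1≈0) (identityˡ a)

  ≤-refl : ∀ {a} → a ≤ a
  ≤-refl {a} = begin
    ~ a ⊕ a                ≈⟨ ∙-congʳ (~-cong (~1⊕ a)) ⟨
    ~ (~ 1# ⊕ a) ⊕ a       ≈⟨ łukasiewicz 1# a ⟩
    ~ (~ a ⊕ 1#) ⊕ 1#      ≈⟨ ⊕-zeroʳ _ ⟩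
    1#                     ∎

  ≤-reflexive : ∀ {a b} → a ≈ b → a ≤ b
  ≤-reflexive a≈b = trans (∙-congˡ (sym a≈b)) ≤-refl

  ∨-comm : ∀ a b → a ∨ b ≈ b ∨ a
  ∨-comm = łukasiewicz

  ≤⇒∨≈ : ∀ {a b} → a ≤ b → a ∨ b ≈ b
  ≤⇒∨≈ {a} {b} a≤b = trans (∙-congʳ (~-cong a≤b)) (~1⊕ b)

  ≤-antisym : ∀ {a b} → a ≤ b → b ≤ a → a ≈ b
  ≤-antisym {a} {b} a≤b b≤a = begin
    a      ≈⟨ ≤⇒∨≈ b≤a ⟨
    b ∨ a  ≈⟨ ∨-comm b a ⟩
    a ∨ b  ≈⟨ ≤⇒∨≈ a≤b ⟩
    b      ∎

  x≤y⊕x : ∀ a b → a ≤ b ⊕ a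
  x≤y⊕x a b = begin
    ~ a ⊕ (b ⊕ a)   ≈⟨ ∙-congˡ (comm b a) ⟩
    ~ a ⊕ (a ⊕ b)   ≈⟨ assoc _ _ _ ⟨
    ~ a ⊕ a ⊕ b     ≈⟨ ∙-congʳ ≤-refl ⟩
    1# ⊕ b          ≈⟨ ⊕-zeroˡ b ⟩
    1#              ∎

  ≤⇒⊖⊕≈ : ∀ {a b} → a ≤ b → (b ⊖ a) ⊕ a ≈ b
  ≤⇒⊖⊕≈ {a} {b} a≤b = trans (∨-comm b a) (≤⇒∨≈ a≤b)

  ≤-respʳ : ∀ {a b c} → b ≈ c → a ≤ b → a ≤ c
  ≤-respʳ b≈c a≤b = trans (∙-congˡ (sym b≈c)) a≤b

  ≤-respˡ : ∀ {a b c} → a ≈ b → a ≤ c → b ≤ c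
  ≤-respˡ a≈b a≤c = trans (∙-congʳ (~-cong (sym a≈b))) a≤c

  -- The order is divisibility: `a ≤ b` makes `b` equal to `(b ⊖ a) ⊕ a`, so `c` becomes `a` plus
  -- two remainders.
  ≤-trans : ∀ {a b c} → a ≤ b → b ≤ c → a ≤ c
  ≤-trans {a} {b} {c} a≤b b≤c = ≤-respʳ eq (x≤y⊕x a ((c ⊖ b) ⊕ (b ⊖ a)))
    where
    eq : (c ⊖ b) ⊕ (b ⊖ a) ⊕ a ≈ c
    eq = begin
      (c ⊖ b) ⊕ (b ⊖ a) ⊕ a    ≈⟨ assoc _ _ _ ⟩
      (c ⊖ b) ⊕ ((b ⊖ a) ⊕ a)  ≈⟨ ∙-congˡ (≤⇒⊖⊕≈ a≤b) ⟩
      (c ⊖ b) ⊕ b              ≈⟨ ≤⇒⊖⊕≈ b≤c ⟩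
      c                        ∎

  ⊕-monoˡ : ∀ {a b} c → a ≤ b → a ⊕ c ≤ b ⊕ c
  ⊕-monoˡ {a} {b} c a≤b = ≤-respʳ eq (x≤y⊕x (a ⊕ c) (b ⊖ a))
    where
    eq : (b ⊖ a) ⊕ (a ⊕ c) ≈ b ⊕ c
    eq = trans (sym (assoc _ _ _)) (∙-congʳ (≤⇒⊖⊕≈ a≤b))

  ⊕-monoʳ : ∀ {a b} c → a ≤ b → c ⊕ a ≤ c ⊕ b
  ⊕-monoʳ c a≤b = ≤-respˡ (comm _ _) (≤-respʳ (comm _ _) (⊕-monoˡ c a≤b))

  ~-antitone : ∀ {a b} → a ≤ b → ~ b ≤ ~ a
  ~-antitone {a} {b} a≤b = begin
    ~ ~ b ⊕ ~ a  ≈⟨ ∙-congʳ (~-involutive b) ⟩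
    b ⊕ ~ a      ≈⟨ comm _ _ ⟩
    ~ a ⊕ b      ≈⟨ a≤b ⟩
    1#           ∎

  ~-swapˡ : ∀ {a b} → ~ a ≤ b → ~ b ≤ a
  ~-swapˡ ~a≤b = ≤-respʳ (~-involutive _) (~-antitone ~a≤b)

  0≤ : ∀ a → 0# ≤ a
  0≤ = ⊕-zeroˡ

  ≤1 : ∀ a → a ≤ 1#
  ≤1 a = ⊕-zeroʳ (~ a)

  ⊖⊕-assoc : ∀ a b c → ~ (a ⊖ b) ⊕ c ≈ ~ a ⊕ (b ⊕ c)
  ⊖⊕-assoc a b c = trans (∙-congʳ (~-involutive _)) (assoc _ _ _)

  -- With its converse, this is the adjunction between subtracting `b` and adding `b`. Both
  -- directions are re-association, because `~ (a ⊖ b)` is `~ a ⊕ b`.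
  ⊖≤⇒≤⊕ : ∀ {a b c} → a ⊖ b ≤ c → a ≤ b ⊕ c
  ⊖≤⇒≤⊕ p = trans (sym (⊖⊕-assoc _ _ _)) p

  ≤⊕⇒⊖≤ : ∀ {a b c} → a ≤ b ⊕ c → a ⊖ b ≤ c
  ≤⊕⇒⊖≤ p = trans (⊖⊕-assoc _ _ _) p

  ⊖-swap : ∀ {a b c} → a ⊖ b ≤ c → a ⊖ c ≤ b
  ⊖-swap p = ≤⊕⇒⊖≤ (≤-respʳ (comm _ _) (⊖≤⇒≤⊕ p))

  ⊖-cong : ∀ {a b c d} → a ≈ b → c ≈ d → a ⊖ c ≈ b ⊖ d
  ⊖-cong p q = ~-cong (∙-cong (~-cong p) q)

  ⊖-monoˡ : ∀ {a b} c → a ≤ b → a ⊖ c ≤ b ⊖ c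
  ⊖-monoˡ c a≤b = ~-antitone (⊕-monoˡ c (~-antitone a≤b))

  ⊖-antiʳ : ∀ {a b} c → a ≤ b → c ⊖ b ≤ c ⊖ a
  ⊖-antiʳ c a≤b = ~-antitone (⊕-monoʳ (~ c) a≤b)

  x⊖y≤x : ∀ a b → a ⊖ b ≤ a
  x⊖y≤x a b = ≤⊕⇒⊖≤ (x≤y⊕x a b)

  x⊖y≤~y : ∀ a b → a ⊖ b ≤ ~ b
  x⊖y≤~y a b = ~-antitone (x≤y⊕x b (~ a))

  1⊖x≈~x : ∀ a → 1# ⊖ a ≈ ~ a
  1⊖x≈~x a = ~-cong (~1⊕ a)

  x⊖1≈0 : ∀ a → a ⊖ 1# ≈ 0#
  x⊖1≈0 a = trans (~-cong (⊕-zeroʳ _)) ~1≈0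

  ~-⊖ : ∀ a b → ~ a ⊖ ~ b ≈ b ⊖ a
  ~-⊖ a b = ~-cong (trans (∙-congʳ (~-involutive a)) (comm a (~ b)))

  ⊖⊖≈⊖⊕ : ∀ a b c → (a ⊖ b) ⊖ c ≈ a ⊖ (b ⊕ c)
  ⊖⊖≈⊖⊕ a b c = ~-cong (⊖⊕-assoc a b c)

  ≤⊖⊕ : ∀ a b → a ≤ (a ⊖ b) ⊕ b
  ≤⊖⊕ a b = ≤-respʳ (comm _ _) (⊖≤⇒≤⊕ ≤-refl)

  ⊕⊖≤ : ∀ a b → (a ⊕ b) ⊖ b ≤ a
  ⊕⊖≤ a b = ≤⊕⇒⊖≤ (≤-reflexive (comm _ _))

  ≤⇒⊖≤0 : ∀ {a b} → a ≤ b → a ⊖ b ≤ 0#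
  ≤⇒⊖≤0 a≤b = ≤⊕⇒⊖≤ (≤-respʳ (sym (identityʳ _)) a≤b)

  ⊖≤0⇒≤ : ∀ {a b} → a ⊖ b ≤ 0# → a ≤ b
  ⊖≤0⇒≤ p = ≤-respʳ (identityʳ _) (⊖≤⇒≤⊕ p)

  ⊖-triangle : ∀ a b c → a ⊖ c ≤ (b ⊖ c) ⊕ (a ⊖ b)
  ⊖-triangle a b c = ≤⊕⇒⊖≤ (≤-respʳ (assoc _ _ _)
    (≤-trans (⊖≤⇒≤⊕ ≤-refl) (⊕-monoˡ _ (⊖≤⇒≤⊕ ≤-refl))))

  x≤x∨y : ∀ a b → a ≤ a ∨ b
  x≤x∨y = ≤⊖⊕

  y≤x∨y : ∀ a b → b ≤ a ∨ b
  y≤x∨y a b = x≤y⊕x b _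

  ∨-least : ∀ {a b c} → a ≤ c → b ≤ c → a ∨ b ≤ c
  ∨-least {b = b} a≤c b≤c = ≤-respʳ (≤⇒⊖⊕≈ b≤c) (⊕-monoˡ b (⊖-monoˡ b a≤c))

  x∧y≤x : ∀ a b → a ∧ b ≤ a
  x∧y≤x a b = x⊖y≤x a _

  x∧y≤y : ∀ a b → a ∧ b ≤ b
  x∧y≤y a b = ⊖-swap ≤-refl

  ∧≈~∨~ : ∀ a b → a ∧ b ≈ ~ (~ b ∨ ~ a)
  ∧≈~∨~ a b = ~-cong (trans (comm _ _) (∙-congʳ (sym (~-⊖ b a))))

  ∧-greatest : ∀ {a b c} → c ≤ a → c ≤ b → c ≤ a ∧ b
  ∧-greatest {a} {b} {c} c≤a c≤b = ≤-respˡ (~-involutive c) (≤-respʳ (sym (∧≈~∨~ a b))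
    (~-antitone (∨-least (~-antitone c≤b) (~-antitone c≤a))))

  ∧-mono : ∀ {a b c d} → a ≤ b → c ≤ d → a ∧ c ≤ b ∧ d
  ∧-mono p q = ∧-greatest (≤-trans (x∧y≤x _ _) p) (≤-trans (x∧y≤y _ _) q)

  ∨-mono : ∀ {a b c d} → a ≤ b → c ≤ d → a ∨ c ≤ b ∨ d
  ∨-mono p q = ∨-least (≤-trans p (x≤x∨y _ _)) (≤-trans q (y≤x∨y _ _))

  -- Measures how far cancellation fails: adding and then subtracting `b` truncates `a` at `~ b`, so
  -- it is harmless for elements below `~ b`.
  ~y∧x≈x⊕y⊖y : ∀ a b → ~ b ∧ a ≈ (a ⊕ b) ⊖ b
  ~y∧x≈x⊕y⊖y a b = ~-cong (begin
    ~ ~ b ⊕ ~ (~ ~ b ⊕ a) ≈⟨ ∙-cong (~-involutive b) (~-cong (∙-congʳ (~-involutive b))) ⟩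
    b ⊕ ~ (b ⊕ a)         ≈⟨ comm _ _ ⟩
    ~ (b ⊕ a) ⊕ b         ≈⟨ ∙-congʳ (~-cong (comm b a)) ⟩
    ~ (a ⊕ b) ⊕ b         ∎)

  -- Adding e to the meet m of a and b stays below a and b, and e ≤ ¬ m allows cancelling m.
  prelinear : ∀ {a b e} → e ≤ a ⊖ b → e ≤ b ⊖ a → e ≤ 0#
  prelinear {a} {b} {e} p q = ≤-trans e≤ (≤⇒⊖≤0 e⊕m≤m)
    where
    m = a ∧ b
    a⊖b≤a⊖m : a ⊖ b ≤ a ⊖ m
    a⊖b≤a⊖m = ⊖-antiʳ a (x∧y≤y a b)
    b⊖a≤b⊖m : b ⊖ a ≤ b ⊖ m
    b⊖a≤b⊖m = ⊖-antiʳ b (x∧y≤x a b)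
    ⊖m⊕m : ∀ {c} → m ≤ c → e ≤ c ⊖ m → e ⊕ m ≤ c
    ⊖m⊕m m≤c r = ≤-respʳ (≤⇒⊖⊕≈ m≤c) (⊕-monoˡ m r)
    e⊕m≤m : e ⊕ m ≤ m
    e⊕m≤m = ∧-greatest (⊖m⊕m (x∧y≤x a b) (≤-trans p a⊖b≤a⊖m))
                       (⊖m⊕m (x∧y≤y a b) (≤-trans q b⊖a≤b⊖m))
    e≤ : e ≤ (e ⊕ m) ⊖ m
    e≤ = ≤-respʳ (~y∧x≈x⊕y⊖y e m)
           (∧-greatest (≤-trans p (≤-trans a⊖b≤a⊖m (x⊖y≤~y a m))) ≤-refl)

  -- By `⊖-triangle`, what the left side has in excess of the right is below `a ⊖ m` and below
  -- `b ⊖ m`, hence below `a ⊖ b` and `b ⊖ a`.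
  ∧-⊖-distrib : ∀ a b c → (a ⊖ c) ∧ (b ⊖ c) ≤ (a ∧ b) ⊖ c
  ∧-⊖-distrib a b c = ⊖≤0⇒≤ (prelinear (bound a a⊖m (x∧y≤x _ _)) (bound b b⊖m (x∧y≤y _ _)))
    where
    m = a ∧ b
    a⊖m : a ⊖ m ≤ a ⊖ b
    a⊖m = ⊖-swap ≤-refl
    b⊖m : b ⊖ m ≤ b ⊖ a
    b⊖m = ⊖-swap (∧-greatest (⊖-swap ≤-refl) (x⊖y≤x b _))
    bound : ∀ d {e} → d ⊖ m ≤ e → ∀ {u} → u ≤ d ⊖ c → u ⊖ (m ⊖ c) ≤ e
    bound d d⊖m≤e u≤ = ≤⊕⇒⊖≤ (≤-trans u≤ (≤-trans (⊖-triangle d m c) (⊕-monoʳ _ d⊖m≤e)))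

  ∨-⊖-distrib : ∀ a b c → (a ∨ b) ⊖ c ≤ (a ⊖ c) ∨ (b ⊖ c)
  ∨-⊖-distrib a b c = ≤⊕⇒⊖≤ (∨-least (⊖≤⇒≤⊕ (x≤x∨y _ _)) (⊖≤⇒≤⊕ (y≤x∨y _ _)))

  ⊖-∧-distrib : ∀ a b c → a ⊖ (b ∧ c) ≤ (a ⊖ b) ∨ (a ⊖ c)
  ⊖-∧-distrib a b c = ⊖-swap (∧-greatest (⊖-swap (x≤x∨y _ _)) (⊖-swap (y≤x∨y _ _)))

  ~∧~≤~∨ : ∀ a b → ~ a ∧ ~ b ≤ ~ (a ∨ b)
  ~∧~≤~∨ a b = ≤-respˡ (~-involutive _) (~-antitone
    (∨-least (≤-respˡ (~-involutive a) (~-antitone (x∧y≤x _ _)))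
             (≤-respˡ (~-involutive b) (~-antitone (x∧y≤y _ _)))))

  ~∧≤~∨~ : ∀ a b → ~ (a ∧ b) ≤ ~ b ∨ ~ a
  ~∧≤~∨~ a b = ~-swapˡ (≤-reflexive (sym (∧≈~∨~ a b)))

  ⊖-∨-distrib : ∀ a b c → (a ⊖ b) ∧ (a ⊖ c) ≤ a ⊖ (b ∨ c)
  ⊖-∨-distrib a b c = ≤-trans
    (∧-mono (≤-reflexive (sym (flip-⊖ b))) (≤-reflexive (sym (flip-⊖ c))))
    (≤-trans (∧-⊖-distrib (~ b) (~ c) (~ a))
    (≤-trans (⊖-monoˡ (~ a) (~∧~≤~∨ b c)) (≤-reflexive (flip-⊖ (b ∨ c)))))
    where
    flip-⊖ : ∀ d → ~ d ⊖ ~ a ≈ a ⊖ d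
    flip-⊖ d = ~-⊖ d a

  -- In a chain one would distinguish `c ≤ d` from `d ≤ c`. Here the excess of the left side over
  -- the right is below both `c ⊖ d` and `d ⊖ c`, so `prelinear` applies.
  ⊖-interchange : ∀ a b c d → (a ⊖ d) ∧ (b ⊖ c) ≤ (a ⊖ c) ∨ (b ⊖ d)
  ⊖-interchange a b c d = ⊖≤0⇒≤ (prelinear {c} {d}
    (bound a c d (x∧y≤x _ _) (x≤x∨y _ _)) (bound b d c (x∧y≤y _ _) (y≤x∨y _ _)))
    where
    bound : ∀ a c d {u v} → u ≤ a ⊖ d → a ⊖ c ≤ v → u ⊖ v ≤ c ⊖ d
    bound a c d p q = ≤⊕⇒⊖≤ (≤-trans p (≤-trans (≤⊕⇒⊖≤
      (≤-trans (⊖≤⇒≤⊕ ≤-refl)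
      (≤-respʳ (trans (assoc _ _ _) (∙-congˡ (comm _ _))) (⊕-monoˡ _ (⊖≤⇒≤⊕ ≤-refl)))))
      (⊕-monoˡ _ q)))

  -- Distributivity of the lattice, in the form needed for the primality of a maximal ideal. As
  -- `b ∨ e` equals `(e ⊖ b) ⊕ b`, each hypothesis bounds `a ⊖ b` by some `e ⊖ b`, and `∧-⊖-distrib`
  -- merges the two bounds.
  ∨-∧-cut : ∀ {a b c d} → a ≤ b ∨ c → a ≤ b ∨ d → a ≤ b ∨ (c ∧ d)
  ∨-∧-cut {a} {b} {c} {d} p q = ≤-respʳ (∨-comm _ _) (≤-respʳ (comm _ _) (⊖≤⇒≤⊕
    (≤-trans (∧-greatest (cut p) (cut q)) (∧-⊖-distrib c d b))))
    where
    cut : ∀ {e} → a ≤ b ∨ e → a ⊖ b ≤ e ⊖ b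
    cut r = ≤⊕⇒⊖≤ (≤-respʳ (comm _ _) (≤-respʳ (∨-comm _ _) r))

  ~⊖≈⊕ : ∀ a b → ~ (~ a ⊖ b) ≈ a ⊕ b
  ~⊖≈⊕ a b = trans (~-involutive _) (∙-congʳ (~-involutive a))

  ⊕-∨-distrib : ∀ a b c → a ⊕ (b ∨ c) ≤ (a ⊕ b) ∨ (a ⊕ c)
  ⊕-∨-distrib a b c = ≤-respˡ (~⊖≈⊕ a (b ∨ c)) (~-swapˡ (≤-trans
    (∧-greatest (flip (x≤x∨y _ _)) (flip (y≤x∨y _ _))) (⊖-∨-distrib (~ a) b c)))
    where
    flip : ∀ {d e} → a ⊕ d ≤ e → ~ e ≤ ~ a ⊖ d
    flip p = ~-swapˡ (≤-respˡ (sym (~⊖≈⊕ a _)) p)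

  ⊕-∧-distrib : ∀ a b c → (a ⊕ b) ∧ (a ⊕ c) ≤ a ⊕ (b ∧ c)
  ⊕-∧-distrib a b c = ≤-respʳ (~⊖≈⊕ a (b ∧ c)) (≤-trans
    (∧-mono (≤-reflexive (sym (~⊖≈⊕ a b))) (≤-reflexive (sym (~⊖≈⊕ a c))))
    (≤-trans (~∧~≤~∨ _ _) (~-antitone (⊖-∧-distrib (~ a) b c))))

-- A record, because a parameter with hidden arguments is η-expanded wherever it is passed on, and
-- types mentioning it then cease to be syntactically equal.
record Axioms : Setω where
  constructor axioms
  field
    excluded-middle : ∀ {a} → ExcludedMiddle a
    extensionality  : ∀ {a b} → Extensionality a b

-- Classical logic and Tukey's lemma

module Classical (ax : Axioms) (ℓ : Level) where

  open Axioms ax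

  decide : ∀ {p} (P : Set p) → Dec P
  decide P = excluded-middle

  -- Excluded middle turns every proposition, of any level, into a Bool, so that the subsets
  -- Carrier → Bool of a type in Set ℓ again form a type in Set ℓ.
  data True : Bool → Set ℓ where
    tt : True true

  opaque
    ⌊_⌋ : ∀ {p} → Set p → Bool
    ⌊ P ⌋ = does (decide P)

    ⌊⌋⁺ : ∀ {p} {P : Set p} → P → True ⌊ P ⌋
    ⌊⌋⁺ {P = P} x with decide P
    ... | yes _ = tt
    ... | no ¬x = contradiction x ¬x

    ⌊⌋⁻ : ∀ {p} {P : Set p} → True ⌊ P ⌋ → P
    ⌊⌋⁻ {P = P} t with decide P
    ... | yes x = x
    ⌊⌋⁻ {P = P} () | no _

  opaque
    stable : ∀ {p} {P : Set p} → ¬ ¬ P → P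
    stable {P = P} ¬¬x with decide P
    ... | yes x = x
    ... | no ¬x = contradiction ¬x ¬¬x

  True-injective : ∀ {b c} → (True b → True c) → (True c → True b) → b ≡ c
  True-injective {true}  {true}  _ _ = ≡-refl
  True-injective {true}  {false} f _ with () ← f tt
  True-injective {false} {true}  _ g with () ← g tt
  True-injective {false} {false} _ _ = ≡-refl

  -- Tukey's lemma for a property P of finite character.  The tower generated by adding one element
  -- whenever possible and by unions is a chain (Bourbaki–Witt), so its union is maximal.
  module Tukey {E : Set ℓ} {p} (P : List E → Set p)
               (P-anti : ∀ {l l′} → l ⊆ᴸ l′ → P l′ → P l) (P[] : P []) where

    Subset : Set ℓ
    Subset = E → Bool

    infix 4 _∋_ _⊑_

    _∋_ : Subset → E → Set ℓ
    S ∋ e = True (S e)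

    _⊑_ : Subset → Subset → Set ℓ
    S ⊑ S′ = ∀ {e} → S ∋ e → S′ ∋ e

    ⊑-antisym : ∀ {S S′} → S ⊑ S′ → S′ ⊑ S → S ≡ S′
    ⊑-antisym p q = extensionality λ _ → True-injective p q

    Good : Subset → Set _
    Good S = ∀ {l} → All (S ∋_) l → P l

    insert : E → Subset → Subset
    insert e S x = ⌊ x ≡ e ⊎ S ∋ x ⌋

    Extensible : Subset → Set _
    Extensible S = ∃ λ e → ¬ (S ∋ e) × Good (insert e S)

    -- The element to add is whichever one `decide` returns, so the step is a function of `S` alone.
    step : Subset → Subset
    step S with decide (Extensible S)
    ... | yes (e , _) = insert e S
    ... | no _        = S

    step-increasing : ∀ S → S ⊑ step S
    step-increasing S s with decide (Extensible S)
    ... | yes _ = ⌊⌋⁺ (inj₂ s)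
    ... | no _  = s

    step-good : ∀ S → Good S → Good (step S)
    step-good S g with decide (Extensible S)
    ... | yes (_ , _ , g′) = g′
    ... | no _             = g

    step-fixed : ∀ S → step S ⊑ S → ¬ Extensible S
    step-fixed S fix with decide (Extensible S)
    ... | yes (e , e∉S , _) = λ _ → e∉S (fix (⌊⌋⁺ (inj₁ ≡-refl)))
    ... | no ¬x             = ¬x

    union : (Subset → Bool) → Subset
    union Q e = ⌊ ∃ (λ S → True (Q S) × S ∋ e) ⌋

    -- The union of the empty family starts the tower at the empty set.
    data Tower : Subset → Set ℓ where
      next : ∀ {S} → Tower S → Tower (step S)
      sup  : ∀ Q → (∀ S → True (Q S) → Tower S) → Tower (union Q)

    ⊑union : ∀ Q {S} → True (Q S) → S ⊑ union Q
    ⊑union Q q s = ⌊⌋⁺ (_ , q , s)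

    union⊑ : ∀ Q {S′} → (∀ {S} → True (Q S) → S ⊑ S′) → union Q ⊑ S′
    union⊑ Q h s with _ , q , s′ ← ⌊⌋⁻ s = h q s′

    -- The extreme elements of the Bourbaki-Witt argument: a step taken strictly below `C` cannot
    -- jump over `C`.
    Extreme : Subset → Set ℓ
    Extreme C = ∀ {S} → Tower S → S ⊑ C → S ≢ C → step S ⊑ C

    extreme-splits : ∀ {C} → Extreme C → ∀ {S} → Tower S → S ⊑ C ⊎ step C ⊑ S
    extreme-splits {C} x (next {S} t) with extreme-splits x t
    ... | inj₂ q = inj₂ λ c → step-increasing S (q c)
    ... | inj₁ q with decide (S ≡ C)
    ...   | yes ≡-refl = inj₂ λ c → c
    ...   | no S≢C     = inj₁ (x t q S≢C)
    extreme-splits {C} x (sup Q ts) with decide (∃ λ S → True (Q S) × step C ⊑ S)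
    ... | yes (_ , q , r) = inj₂ λ c → ⊑union Q q (r c)
    ... | no ¬r           = inj₁ (union⊑ Q λ {S} q → below q (extreme-splits x (ts S q)))
      where
      below : ∀ {S} → True (Q S) → S ⊑ C ⊎ step C ⊑ S → S ⊑ C
      below q (inj₁ r) = r
      below q (inj₂ r) = ⊥-elim (¬r (_ , q , r))

    -- The induction is on `C`. Its predecessor, or each member of the family it is the union of, is
    -- already extreme, so `extreme-splits` compares `S` with that set.
    tower-extreme : ∀ {C} → Tower C → Extreme C
    tower-extreme (next {C} t) {S} tS S⊑ S≢ with extreme-splits (tower-extreme t) tS
    ... | inj₂ r = contradiction (⊑-antisym S⊑ r) S≢
    ... | inj₁ r with decide (S ≡ C)
    ...   | yes ≡-refl = λ s → s
    ...   | no S≢C     = λ s → step-increasing C (tower-extreme t tS r S≢C s)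
    tower-extreme (sup Q ts) {S} tS S⊑ S≢ with decide (∃ λ C → True (Q C) × S ⊑ C)
    ... | no ¬r = contradiction (⊑-antisym S⊑
                    (union⊑ Q λ {C} q → above q (extreme-splits (tower-extreme (ts C q)) tS))) S≢
      where
      above : ∀ {C} → True (Q C) → S ⊑ C ⊎ step C ⊑ S → C ⊑ S
      above q (inj₁ r) = ⊥-elim (¬r (_ , q , r))
      above q (inj₂ r) c = r (step-increasing _ c)
    ... | yes (C , q , r) with decide (S ≡ C)
    ...   | no S≢C = λ s → ⊑union Q q (tower-extreme (ts C q) tS r S≢C s)
    -- Here `S` is itself a member of the family, so the union is compared with `S` instead.
    ...   | yes ≡-refl with extreme-splits (tower-extreme (ts C q)) (sup Q ts)
    ...     | inj₁ s = contradiction (⊑-antisym S⊑ s) S≢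
    ...     | inj₂ s = s

    tower-linear : ∀ {S S′} → Tower S → Tower S′ → S ⊑ S′ ⊎ S′ ⊑ S
    tower-linear {S} t t′ with extreme-splits (tower-extreme t) t′
    ... | inj₁ r = inj₂ r
    ... | inj₂ r = inj₁ λ s → r (step-increasing S s)

    -- By linearity of the tower one member can absorb finitely many elements. The list is nonempty
    -- because an empty family has no member to offer.
    finite-in-member : ∀ Q → (∀ S → True (Q S) → Tower S) → ∀ {e l} → All (union Q ∋_) (e ∷ l) →
                       ∃ λ S → True (Q S) × All (S ∋_) (e ∷ l)
    finite-in-member Q ts (s ∷ []) with _ , q , s′ ← ⌊⌋⁻ s = _ , q , s′ ∷ []
    finite-in-member Q ts (s ∷ ss@(_ ∷ _))
      with S , q , s′ ← ⌊⌋⁻ s | S′ , q′ , ss′ ← finite-in-member Q ts ss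
      with tower-linear (ts S q) (ts S′ q′)
    ... | inj₁ r = S′ , q′ , r s′ ∷ ss′
    ... | inj₂ r = S , q , s′ ∷ All.map r ss′

    tower-good : ∀ {S} → Tower S → Good S
    tower-good (next {S} t) = step-good S (tower-good t)
    tower-good (sup Q ts) [] = P[]
    tower-good (sup Q ts) ss@(_ ∷ _) with S , q , ss′ ← finite-in-member Q ts ss =
      tower-good (ts S q) ss′

    M : Subset
    M = union λ S → ⌊ Tower S ⌋

    M-tower : Tower M
    M-tower = sup _ λ _ → ⌊⌋⁻

    M-good : Good M
    M-good = tower-good M-tower

    split-insert : ∀ e {l} → All (insert e M ∋_) l → ∃ λ l′ → All (M ∋_) l′ × l ⊆ᴸ e ∷ l′
    split-insert e [] = [] , [] , λ ()
    split-insert e (s ∷ ss) with ⌊⌋⁻ s | split-insert e ss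
    ... | inj₁ ≡-refl | l′ , ms , sub = l′ , ms , λ { (here ≡-refl) → here ≡-refl ; (there i) → sub i }
    ... | inj₂ m | l′ , ms , sub = _ ∷ l′ , m ∷ ms ,
      λ { (here ≡-refl) → there (here ≡-refl) ; (there i) → weaken (sub i) }
      where
      weaken : ∀ {x y} → x ∈ᴸ e ∷ l′ → x ∈ᴸ e ∷ y ∷ l′
      weaken (here p)  = here p
      weaken (there i) = there (there i)

    -- The set `step M` is in the tower, hence inside `M`, so `M` is not extensible. A finite part
    -- of `insert e M` is contained in `e` together with a finite part of `M`, so the hypothesis
    -- makes `insert e M` good.
    M-maximal : ∀ e → (∀ {l} → All (M ∋_) l → P (e ∷ l)) → M ∋ e
    M-maximal e h = stable λ e∉M → step-fixed M (⊑union _ (⌊⌋⁺ (next M-tower)))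
      (e , e∉M , λ ss → let l′ , ms , sub = split-insert e ss in P-anti sub (h ms))

-- Open sets and compactness

module TopologyProperties (ax : Axioms) {ℓ m} {S : Setoid ℓ ℓ}
                          (𝒮 : Topology S m) where
  open Setoid S using (Carrier)
  open Topology 𝒮
  open Classical ax ℓ

  opaque
    locally-open : ∀ {U : Pred Carrier ℓ} →
                   (∀ {x} → x ∈ U → ∃ λ N → N ∈ IsOpen × x ∈ N × N ⊆ U) → U ∈ IsOpen
    locally-open {U} nbhd = isOpen-resp
      ((λ ((_ , u) , n) → proj₂ (proj₂ (proj₂ (nbhd u))) n) ,
       (λ u → (_ , u) , proj₁ (proj₂ (proj₂ (nbhd u)))))
      (⋃-open {I = ∃ U} {U = λ (_ , u) → proj₁ (nbhd u)} λ (_ , u) → proj₁ (proj₂ (nbhd u)))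

  opaque
    ∪-open : ∀ {U V} → U ∈ IsOpen → V ∈ IsOpen → U ∪ V ∈ IsOpen
    ∪-open oU oV = locally-open λ
      { (inj₁ u) → _ , oU , u , inj₁ ; (inj₂ v) → _ , oV , v , inj₂ }

  opaque
    All-open : ∀ {I : Set ℓ} {U : I → Pred Carrier ℓ} → (∀ i → U i ∈ IsOpen) →
               ∀ is → (λ x → All (λ i → x ∈ U i) is) ∈ IsOpen
    All-open o []       = isOpen-resp ((λ _ → []) , _) whole
    All-open o (i ∷ is) = isOpen-resp ((λ (p , ps) → p ∷ ps) , (λ { (p ∷ ps) → p , ps }))
                                      (∩-open (o i) (All-open o is))

  Box : ∀ {r} → (Carrier → Carrier → Set r) → Carrier → Carrier → Set (lsuc ℓ ⊔ m ⊔ r)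
  Box R x z = ∃₂ λ N O → N ∈ IsOpen × O ∈ IsOpen × x ∈ N × z ∈ O ×
              (∀ {x′ z′} → x′ ∈ N → z′ ∈ O → R x′ z′)

  module _ (compact : Compact 𝒮) where

    opaque
      closed-compact : ∀ {C : Pred Carrier ℓ} → ∁ C ∈ IsOpen →
                       ∀ {I : Set ℓ} (U : I → Pred Carrier ℓ) → (∀ i → U i ∈ IsOpen) → C ⊆ ⋃ I U →
                       Σ[ is ∈ List I ] (∀ {x} → x ∈ C → Any (λ i → x ∈ U i) is)
      closed-compact {C} oC {I} U oU cover = justs (proj₁ finite) , λ c → select c (proj₂ finite _)
        where
        U⁺ : Maybe I → Pred Carrier ℓ
        U⁺ nothing  = ∁ C
        U⁺ (just i) = U i
        oU⁺ : ∀ i → U⁺ i ∈ IsOpen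
        oU⁺ nothing  = oC
        oU⁺ (just i) = oU i
        cover⁺ : ∀ x → x ∈ ⋃ (Maybe I) U⁺
        cover⁺ x with decide (x ∈ C)
        ... | yes c = let i , u = cover c in just i , u
        ... | no ¬c = nothing , ¬c
        finite : Σ[ is ∈ List (Maybe I) ] (∀ x → Any (λ i → x ∈ U⁺ i) is)
        finite = compact U⁺ oU⁺ cover⁺
        justs : List (Maybe I) → List I
        justs []            = []
        justs (nothing ∷ l) = justs l
        justs (just i ∷ l)  = i ∷ justs l
        select : ∀ {x} → x ∈ C → ∀ {l} → Any (λ i → x ∈ U⁺ i) l → Any (λ i → x ∈ U i) (justs l)
        select c {nothing ∷ _} (here ¬c) = contradiction c ¬c
        select c {nothing ∷ _} (there a) = select c a
        select c {just _ ∷ _}  (here u)  = here u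
        select c {just _ ∷ _}  (there a) = there (select c a)

    opaque
      -- The tube lemma: finitely many of the sets `O z` cover the space, and the matching sets
      -- `N z` are intersected.
      tube : ∀ {r} (R : Carrier → Carrier → Set r) x → (∀ z → Box R x z) →
             ∃ λ N → N ∈ IsOpen × x ∈ N × (∀ {x′} → x′ ∈ N → ∀ z → R x′ z)
      tube R x box = _ , All-open oN (proj₁ finite) , All.universal x∈N _ ,
                     λ ns z → let n , o = All.lookupAny ns (proj₂ finite z) in sub _ n o
        where
        N O : Carrier → Pred Carrier ℓ
        N z = proj₁ (box z)
        O z = proj₁ (proj₂ (box z))
        oN : ∀ z → N z ∈ IsOpen
        oN z = let _ , _ , o , _ = box z in o
        oO : ∀ z → O z ∈ IsOpen
        oO z = let _ , _ , _ , o , _ = box z in o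
        x∈N : ∀ z → x ∈ N z
        x∈N z = let _ , _ , _ , _ , n , _ = box z in n
        z∈O : ∀ z → z ∈ O z
        z∈O z = let _ , _ , _ , _ , _ , o , _ = box z in o
        sub : ∀ z {x′ z′} → x′ ∈ N z → z′ ∈ O z → R x′ z′
        sub z = let _ , _ , _ , _ , _ , _ , s = box z in s
        finite : Σ[ zs ∈ List Carrier ] (∀ z′ → Any (λ z → z′ ∈ O z) zs)
        finite = compact O oO λ z → z , z∈O z

    module _ {k} {K : Set k} (B : K → Pred Carrier ℓ) (closed : ∀ j → ∁ (B j) ∈ IsOpen)
             (top : ∃ λ j → ∀ x → x ∈ B j)
             (meet : ∀ i j → ∃ λ k → B k ⊆ B i ∩ B j × B i ∩ B j ⊆ B k) where

      opaque
        -- The common core of all base arguments below, for spectra as well as for abstract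
        -- Priestley spaces. The complement of `W` is compact and covered by complements of sets
        -- `B j` around `p`; `meet` turns finitely many of these sets into one.
        shrink : ∀ {W} → W ∈ IsOpen → ∀ p → (∀ {q} → q ∉ W → ∃ λ j → p ∈ B j × q ∉ B j) →
                 ∃ λ j → p ∈ B j × B j ⊆ W
        shrink {W} oW p separate = proj₁ ⋂ , proj₁ (proj₂ ⋂) , λ {x} b → stable λ x∉W →
            AllP.Any¬⇒¬All (proj₂ finite x∉W) (proj₂ (proj₂ ⋂) b)
          where
          sep : (i : ∃ (∁ W)) → ∃ λ j → p ∈ B j × proj₁ i ∉ B j
          sep (_ , q∉W) = separate q∉W
          finite : Σ[ is ∈ List (∃ (∁ W)) ] (∀ {x} → x ∈ ∁ W → Any (λ i → x ∉ B (proj₁ (sep i))) is)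
          finite = closed-compact {∁ W}
            (isOpen-resp ((λ w ¬w → ¬w w) , stable) oW)
            (λ i → ∁ (B (proj₁ (sep i)))) (λ i → closed (proj₁ (sep i)))
            λ q∉W → (_ , q∉W) , proj₂ (proj₂ (separate q∉W))
          intersection : ∀ is → ∃ λ j → p ∈ B j × (∀ {x} → x ∈ B j → All (λ i → x ∈ B (proj₁ (sep i))) is)
          intersection [] = proj₁ top , proj₂ top p , λ _ → []
          intersection (i ∷ is) =
            let j , p∈j , sub = intersection is
                k , k⊆ , ⊆k = meet (proj₁ (sep i)) j
            in k , ⊆k (proj₁ (proj₂ (sep i)) , p∈j) ,
               λ x∈k → proj₁ (k⊆ x∈k) ∷ sub (proj₂ (k⊆ x∈k))
          ⋂ : ∃ λ j → p ∈ B j × (∀ {x} → x ∈ B j → All (λ i → x ∈ B (proj₁ (sep i))) (proj₁ finite))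
          ⋂ = intersection (proj₁ finite)

-- Clopen down-sets of a Priestley space

module PriestleyProperties (ax : Axioms) {ℓ} (X : PriestleySpace ℓ) where
  open PriestleySpace X
  open Classical ax ℓ
  open TopologyProperties ax τ public

  -- Membership takes values in `Bool` so that the clopen down-sets form a type in `Set ℓ`, as the
  -- carrier of an MV-algebra must.
  record ClopenDownSet : Set ℓ where
    field
      member   : Carrier → Bool
      isClopen : (λ x → True (member x)) ∈ IsClopen
      isDown   : (λ x → True (member x)) ∈ IsDownSet

  infix 4 _∋_ _∌_

  _∋_ _∌_ : ClopenDownSet → Carrier → Set ℓ
  U ∋ x = True (ClopenDownSet.member U x)
  U ∌ x = ¬ U ∋ x

  open ClopenDownSet public using (isDown)

  isOpen : ∀ U → (U ∋_) ∈ IsOpen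
  isOpen U = proj₁ (ClopenDownSet.isClopen U)

  ∁-isOpen : ∀ U → (U ∌_) ∈ IsOpen
  ∁-isOpen U = proj₂ (ClopenDownSet.isClopen U)

  isUp-∁ : ∀ U {x y} → x ≤ y → U ∌ x → U ∌ y
  isUp-∁ U x≤y x∉U y∈U = x∉U (isDown U x≤y y∈U)

  ∁-resp : ∀ {U V : Pred Carrier ℓ} → U ≐ V → ∁ U ≐ ∁ V
  ∁-resp (U⊆V , V⊆U) = (λ u v → u (V⊆U v)) , (λ v u → v (U⊆V u))

  clopenDownSet : (U : Pred Carrier ℓ) → U ∈ IsOpen → ∁ U ∈ IsOpen → U ∈ IsDownSet → ClopenDownSet
  clopenDownSet U oU o∁U down = record
    { member   = λ x → ⌊ x ∈ U ⌋
    ; isClopen = isOpen-resp ≐⌊⌋ oU , isOpen-resp (∁-resp ≐⌊⌋) o∁U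
    ; isDown   = λ x≤y u → ⌊⌋⁺ (down x≤y (⌊⌋⁻ u))
    }
    where
    ≐⌊⌋ : U ≐ (λ x → True ⌊ x ∈ U ⌋)
    ≐⌊⌋ = ⌊⌋⁺ , ⌊⌋⁻

  opaque
    separate : ∀ {x y} → ¬ x ≤ y → ∃ λ U → U ∋ y × U ∌ x
    separate x≰y = let U , (oU , o∁U) , down , y∈U , x∉U = separated x≰y in
      clopenDownSet U oU o∁U down , ⌊⌋⁺ y∈U , λ u → x∉U (⌊⌋⁻ u)

  ∅ full : ClopenDownSet
  ∅ = clopenDownSet (λ _ → Lift ℓ ⊥) (locally-open λ ()) (isOpen-resp ((λ _ ()) , _) whole) λ _ ()
  full = clopenDownSet (λ _ → ⊤) whole (locally-open λ n → contradiction _ n) _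

  infixr 7 _∩ᶜ_
  infixr 6 _∪ᶜ_

  _∩ᶜ_ _∪ᶜ_ : ClopenDownSet → ClopenDownSet → ClopenDownSet
  U ∩ᶜ V = clopenDownSet (λ x → U ∋ x × V ∋ x) (∩-open (isOpen U) (isOpen V))
    (isOpen-resp ((λ { (inj₁ u) (u′ , _) → u u′ ; (inj₂ v) (_ , v′) → v v′ }) , deMorgan)
                 (∪-open (∁-isOpen U) (∁-isOpen V)))
    λ x≤y (u , v) → isDown U x≤y u , isDown V x≤y v
    where
    deMorgan : ∀ {x} → ¬ (U ∋ x × V ∋ x) → U ∌ x ⊎ V ∌ x
    deMorgan {x} n with decide (U ∋ x)
    ... | yes u = inj₂ λ v → n (u , v)
    ... | no ¬u = inj₁ ¬u
  U ∪ᶜ V = clopenDownSet (λ x → U ∋ x ⊎ V ∋ x) (∪-open (isOpen U) (isOpen V))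
    (isOpen-resp ((λ (u , v) → [ u , v ]′) , (λ n → (λ u → n (inj₁ u)) , (λ v → n (inj₂ v))))
                 (∩-open (∁-isOpen U) (∁-isOpen V)))
    λ { x≤y (inj₁ u) → inj₁ (isDown U x≤y u) ; x≤y (inj₂ v) → inj₂ (isDown V x≤y v) }

  opaque
    -- Clopen up-sets form a base of `τ↑`; they appear here as complements of clopen down-sets.
    shrink-up : ∀ {W} → W ∈ IsOpen → W Respects _≤_ → ∀ {p} → p ∈ W → ∃ λ V → V ∌ p × (V ∌_) ⊆ W
    shrink-up {W} oW up {p} p∈W = shrink compact (λ V x → V ∌ x)
      (λ V → isOpen-resp ((λ v n → n v) , stable) (isOpen V))
      (∅ , λ _ v → lower (⌊⌋⁻ v))
      (λ U V → U ∪ᶜ V , (λ n → (λ u → n (⌊⌋⁺ (inj₁ u))) , (λ v → n (⌊⌋⁺ (inj₂ v)))) ,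
                        (λ (u , v) n → [ u , v ]′ (⌊⌋⁻ n)))
      oW p λ {q} q∉W → let V , q∈V , p∉V = separate λ p≤q → q∉W (up p≤q p∈W) in V , p∉V , λ n → n q∈V

  opaque
    -- Differences of clopen down-sets form a base of `τ`. A point outside `W` differs from `p`, so
    -- by antisymmetry it fails to be below `p` or fails to be above it, and either failure is
    -- witnessed by a clopen down-set.
    shrink-clopen : ∀ {W} → W ∈ IsOpen → ∀ {p} → p ∈ W →
                    ∃ λ U → ∃ λ V → U ∋ p × V ∌ p × (∀ {x} → U ∋ x → V ∌ x → x ∈ W)
    shrink-clopen {W} oW {p} p∈W =
      let (U , V) , (p∈U , p∉V) , sub = shrink compact (λ (U , V) x → U ∋ x × V ∌ x)
            (λ (U , V) → isOpen-resp
               ((λ { (inj₁ u) (u′ , _) → u u′ ; (inj₂ v) (_ , v′) → v′ v }) , deMorgan U V)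
               (∪-open (∁-isOpen U) (isOpen V)))
            ((full , ∅) , λ _ → ⌊⌋⁺ _ , λ v → lower (⌊⌋⁻ v))
            (λ (U , V) (U′ , V′) → (U ∩ᶜ U′ , V ∪ᶜ V′) ,
              (λ (u , v) → (proj₁ (⌊⌋⁻ u) , λ v₁ → v (⌊⌋⁺ (inj₁ v₁))) ,
                           (proj₂ (⌊⌋⁻ u) , λ v₂ → v (⌊⌋⁺ (inj₂ v₂)))) ,
              (λ ((u , v) , (u′ , v′)) → ⌊⌋⁺ (u , u′) , λ n → [ v , v′ ]′ (⌊⌋⁻ n)))
            oW p sep
      in U , V , p∈U , p∉V , λ u v → sub (u , v)
      where
      deMorgan : ∀ U V {x} → ¬ (U ∋ x × V ∌ x) → U ∌ x ⊎ V ∋ x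
      deMorgan U V {x} n with decide (U ∋ x)
      ... | yes u = inj₂ (stable λ v → n (u , v))
      ... | no ¬u = inj₁ ¬u
      sep : ∀ {q} → q ∉ W → ∃ λ ((U , V) : ClopenDownSet × ClopenDownSet) →
                            (U ∋ p × V ∌ p) × ¬ (U ∋ q × V ∌ q)
      sep {q} q∉W with decide (q ≤ p)
      ... | no q≰p = let U , p∈U , q∉U = separate q≰p in
                     (U , ∅) , (p∈U , λ v → lower (⌊⌋⁻ v)) , λ (u , _) → q∉U u
      ... | yes q≤p = let V , q∈V , p∉V = separate λ p≤q → q∉W (respects oW (antisym p≤q q≤p) p∈W) in
                      (full , V) , (⌊⌋⁺ _ , p∉V) , λ (_ , n) → n q∈V

-- The difference of two clopen down-sets

module ⊖SpaceProperties (ax : Axioms) {ℓ} (X : ⊖Space ℓ) where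
  open ⊖Space X
  open Classical ax ℓ
  open PriestleyProperties ax space

  ⋆-lower : ∀ {x y w} (p : (x , y) ∈ dom⋆) (q : (x , w) ∈ dom+) → ¬ w ≤ y →
            x ⋆ y [ p ] ≤ x + w [ q ]
  ⋆-lower p q w≰y = proj₁ (⋆-infimum p) (_ , q , w≰y , Eq.refl)

  opaque
    -- The sums x + w with w ≰ y form a chain, and infima of chains are limits in a Priestley space.
    ⋆-attained : ∀ U {x y} (p : (x , y) ∈ dom⋆) → U ∋ x ⋆ y [ p ] →
                 ∃ λ w → Σ[ q ∈ (x , w) ∈ dom+ ] ¬ w ≤ y × U ∋ x + w [ q ]
    ⋆-attained U {x} {y} p x⋆y∈U = stable λ none →
      let is , cover = closed-compact compact {C = U ∌_}
                         (isOpen-resp ((λ u n → n u) , stable) (isOpen U))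
                         (λ i → D i ∌_) (λ i → ∁-isOpen (D i))
                         λ v∉U → (_ , v∉U) , D∌ (_ , v∉U)
          w , q , w≰y , ds = minimum is
      in AllP.Any¬⇒¬All (cover λ u → none (w , q , w≰y , u)) ds
      where
      not-lower-bound : ∀ {v} → U ∌ v → ∃ λ w → Σ[ q ∈ (x , w) ∈ dom+ ] ¬ w ≤ y × ¬ v ≤ x + w [ q ]
      not-lower-bound {v} v∉U = stable λ none → v∉U (isDown U (proj₂ (⋆-infimum p)
        λ { (w , q , w≰y , eq) → trans (stable λ v≰ → none (w , q , w≰y , v≰)) (reflexive (Eq.sym eq)) }) x⋆y∈U)
      -- A point outside `U` is not a lower bound of the sums, so some `D` misses it while
      -- containing a sum. If all sums were outside `U`, finitely many such `D` would cover the
      -- complement of `U`, yet the least of their sums lies in every one of them.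
      below : (i : ∃ (U ∌_)) → ∃ λ D → D ∌ proj₁ i × ∃ λ w → Σ[ q ∈ (x , w) ∈ dom+ ] ¬ w ≤ y × D ∋ x + w [ q ]
      below (_ , v∉U) = let w , q , w≰y , v≰ = not-lower-bound v∉U
                            D , d , d∌ = separate v≰
                        in D , d∌ , w , q , w≰y , d
      D : ∃ (U ∌_) → ClopenDownSet
      D i = proj₁ (below i)
      D∌ : ∀ i → D i ∌ proj₁ i
      D∌ i = proj₁ (proj₂ (below i))
      minimum : ∀ is → ∃ λ w → Σ[ q ∈ (x , w) ∈ dom+ ] ¬ w ≤ y × All (λ i → D i ∋ x + w [ q ]) is
      minimum [] = i x , refl , p , []
      minimum (j ∷ is) with minimum is
      ... | w , q , w≰y , ds =
        let w′ , q′ , w′≰y , d′ = proj₂ (proj₂ (below j))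
        in [ (λ le → w , q , w≰y , isDown (D j) le d′ ∷ ds)
           , (λ le → w′ , q′ , w′≰y , d′ ∷ All.map (λ {i} → isDown (D i) le) ds) ]′
           (L-total x (w , q) (w′ , q′))

  opaque
    L♯-bound : ∀ {x z} → x ≤ z → ∃ λ w → Σ[ q ∈ (x , w) ∈ dom+ ] x + w [ q ] ≤ z ×
               (∀ {v} (p : (x , v) ∈ dom+) → x + v [ p ] ≤ z → v ≤ w)
    L♯-bound {x} {z} x≤z =
      let L♯ , adj = L-adj x
          w , q = L♯ (z , x≤z)
      in w , q , proj₂ (adj {w , q} {z , x≤z}) refl , λ {v} p → proj₁ (adj {v , p} {z , x≤z})

  opaque
    -- The order need not have joins. The upper adjoint, taken at the larger of the two sums,
    -- dominates both `v` and `w` without leaving `U`.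
    L-join : ∀ U {x v w} (p : (x , v) ∈ dom+) (q : (x , w) ∈ dom+) →
             U ∋ x + v [ p ] → U ∋ x + w [ q ] →
             ∃ λ u → Σ[ r ∈ (x , u) ∈ dom+ ] U ∋ x + u [ r ] × v ≤ u × w ≤ u
    L-join U {x} {v} {w} p q v-in w-in with L-total x (v , p) (w , q)
    ... | inj₁ le with L♯-bound (+-increasing q)
    ...   | u , r , x+u≤ , greatest = u , r , isDown U x+u≤ w-in , greatest p le , greatest q refl
    L-join U {x} {v} {w} p q v-in w-in | inj₂ le with L♯-bound (+-increasing p)
    ...   | u , r , x+u≤ , greatest = u , r , isDown U x+u≤ v-in , greatest p refl , greatest q le

  Difference : ClopenDownSet → ClopenDownSet → Pred Carrier ℓ
  Difference U V x = ∃ λ z → Σ[ p ∈ (x , z) ∈ dom+ ] V ∌ z × U ∋ x + z [ p ]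

  Difference⋆ : ClopenDownSet → ClopenDownSet → Pred Carrier ℓ
  Difference⋆ U V x = U ∋ x × ∀ y → V ∋ y → Σ[ p ∈ (x , y) ∈ dom⋆ ] U ∋ x ⋆ y [ p ]

  opaque
    Difference⊆⋆ : ∀ U V → Difference U V ⊆ Difference⋆ U V
    Difference⊆⋆ U V {x} (z , p , z∉V , u) = isDown U (+-increasing p) u , λ y y∈V →
      let d : (x , y) ∈ dom⋆
          d ix≤y = z∉V (isDown V (trans p ix≤y) y∈V)
      in d , isDown U (⋆-lower d p λ z≤y → z∉V (isDown V z≤y y∈V)) u

  opaque
    ↑-closed : ∀ w → (λ v → ¬ w ≤ v) ∈ IsOpen
    ↑-closed w = locally-open λ w≰v → let D , v∈D , w∉D = separate w≰v in
      _ , isOpen D , v∈D , λ d w≤u → w∉D (isDown D w≤u d)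

  opaque
    -- Each `y` in `V` has a summand not below it whose sum with `x` is in `U`. By compactness of
    -- `V` finitely many summands serve all `y`, and `L-join` bounds them by one `w`. This `w`
    -- cannot be in `V`, since one of the summands would then fail to be below it.
    Difference⋆⊆ : ∀ U V → Difference⋆ U V ⊆ Difference U V
    Difference⋆⊆ U V {x} (x∈U , h) =
      let w , q , u , bounds = bound (proj₁ finite)
      in w , q , (λ w∈V → AllP.Any¬⇒¬All (proj₂ finite w∈V) bounds) , u
      where
      witness : ((y , _) : ∃ (V ∋_)) → ∃ λ w → Σ[ q ∈ (x , w) ∈ dom+ ] ¬ w ≤ y × U ∋ x + w [ q ]
      witness (y , y∈V) = let p , u = h y y∈V in ⋆-attained U p u
      finite : Σ[ is ∈ List (∃ (V ∋_)) ] (∀ {v} → V ∋ v → Any (λ i → ¬ proj₁ (witness i) ≤ v) is)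
      finite = closed-compact compact (∁-isOpen V) (λ i v → ¬ proj₁ (witness i) ≤ v)
        (λ i → ↑-closed (proj₁ (witness i)))
        (λ y∈V → (_ , y∈V) , proj₁ (proj₂ (proj₂ (witness (_ , y∈V)))))
      bound : ∀ is → ∃ λ w → Σ[ q ∈ (x , w) ∈ dom+ ] U ∋ x + w [ q ] ×
                     All (λ i → proj₁ (witness i) ≤ w) is
      -- With nothing to dominate, the upper adjoint at `x` itself gives `w` with `x + w ≤ x`; here
      -- `x∈U` is used.
      bound [] = let w , q , x+w≤x , _ = L♯-bound refl in w , q , isDown U x+w≤x x∈U , []
      bound (i ∷ is) with bound is
      ... | _ , q , w-in , bs
        with L-join U (proj₁ (proj₂ (witness i))) q (proj₂ (proj₂ (proj₂ (witness i)))) w-in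
      ...   | u , r , u-in , v≤u , w≤u = u , r , u-in , v≤u ∷ All.map (λ b → trans b w≤u) bs

  opaque
    Difference-open : ∀ U V → Difference U V ∈ IsOpen
    Difference-open U V = locally-open nbhd
      where
      box : ∀ {x} → (∀ y → V ∋ y → Σ[ p ∈ (x , y) ∈ dom⋆ ] U ∋ x ⋆ y [ p ]) → ∀ y →
            Box (λ x y → V ∋ y → Σ[ p ∈ (x , y) ∈ dom⋆ ] U ∋ x ⋆ y [ p ]) x y
      box {x} h y with decide (V ∋ y)
      ... | no y∉V = (λ _ → ⊤) , (V ∌_) , whole , ∁-isOpen V , _ , y∉V , λ _ n v → contradiction v n
      ... | yes y∈V with h y y∈V
      -- The set `D` keeps `i x′ ≰ y′` true near `(x , y)`, so that `⋆` stays defined there, and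
      -- lower continuity keeps its value in `U`.
      ...   | p , u with separate p | ⋆-continuous {U ∋_} (isOpen U , isDown U)
      ...     | D , y∈D , ix∉D | _ , oW , W⊆ , ⊆W with oW (W⊆ {(x , y) , p} u)
      ...       | N , O , (oN , _) , (oO , _) , x∈N , y∈O , sub =
        N ∩ (λ x → D ∌ i x) , O ∩ (D ∋_) , ∩-open oN (i-continuous (∁-isOpen D)) , ∩-open oO (isOpen D) ,
        (x∈N , ix∉D) , (y∈O , y∈D) , λ {x′} {y′} (n , ix′∉D) (o , y′∈D) _ →
          (λ le → ix′∉D (isDown D le y′∈D)) , ⊆W {(x′ , y′) , _} (sub n o)
      nbhd : ∀ {x} → x ∈ Difference U V → ∃ λ N → N ∈ IsOpen × x ∈ N × N ⊆ Difference U V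
      nbhd d with Difference⊆⋆ U V d
      ... | x∈U , h with tube compact _ _ (box h)
      ...   | N , oN , x∈N , sub = (U ∋_) ∩ N , ∩-open (isOpen U) oN , (x∈U , x∈N) ,
                                   λ (u , n) → Difference⋆⊆ U V (u , sub n)

  opaque
    Difference-closed : ∀ U V → ∁ (Difference U V) ∈ IsOpen
    Difference-closed U V = locally-open nbhd
      where
      box : ∀ {x} → x ∉ Difference U V → ∀ z →
            Box (λ x z → ∀ (p : (x , z) ∈ dom+) → V ∌ z → U ∌ x + z [ p ]) x z
      box {x} ∉d z with decide (V ∋ z) | decide (z ≤ i x)
      ... | yes z∈V | _ = (λ _ → ⊤) , (V ∋_) , whole , isOpen V , _ , z∈V , λ _ v _ z∉V → contradiction v z∉V
      ... | no _ | no z≰ix with separate z≰ix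
      ...   | D , ix∈D , z∉D =
        (λ x → D ∋ i x) , (D ∌_) , i-continuous (isOpen D) , ∁-isOpen D , ix∈D , z∉D ,
        λ d n le _ _ → n (isDown D le d)
      box {x} ∉d z | no z∉V | yes p with +-continuous {U ∌_} (∁-isOpen U , isUp-∁ U)
      ...   | _ , oW , W⊆ , ⊆W with oW (W⊆ {(x , z) , p} λ u → ∉d (z , p , z∉V , u))
      ...     | N , O , (oN , _) , (oO , _) , x∈N , y∈O , sub =
        N , O , oN , oO , x∈N , y∈O , λ n o p′ _ → ⊆W {_ , p′} (sub n o)
      nbhd : ∀ {x} → x ∉ Difference U V → ∃ λ N → N ∈ IsOpen × x ∈ N × N ⊆ ∁ (Difference U V)
      nbhd ∉d with tube compact _ _ (box ∉d)
      ... | N , oN , x∈N , sub = N , oN , x∈N , λ n (z , p , z∉V , u) → sub n z p z∉V u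

  infixl 6 _⊖ᶜ_
  infix  8 ~ᶜ_

  _⊖ᶜ_ : ClopenDownSet → ClopenDownSet → ClopenDownSet
  U ⊖ᶜ V = clopenDownSet (Difference U V) (Difference-open U V) (Difference-closed U V)
    λ x′≤x (z , p , z∉V , u) → let p′ = trans p (i-antitone x′≤x) in
      z , p′ , z∉V , isDown U (+-monoˡ p′ p x′≤x) u

  ~ᶜ_ : ClopenDownSet → ClopenDownSet
  ~ᶜ U = clopenDownSet (λ x → U ∌ i x) (i-continuous (∁-isOpen U))
    (isOpen-resp ((λ u n → n u) , stable) (i-continuous (isOpen U)))
    λ x≤y → isUp-∁ U (i-antitone x≤y)

-- The MV-algebra of clopen down-sets of an MV-space

module ClopenDownSets (ax : Axioms) {ℓ} (X : ⊖Space ℓ) (mv : IsMVSpace X) where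
  open ⊖Space X
  open IsMVSpace mv
  open Classical ax ℓ
  open PriestleyProperties ax space
  open ⊖SpaceProperties ax X

  ≤ii : ∀ {x} → x ≤ i (i x)
  ≤ii = reflexive (Eq.sym (i-involutive _))

  ii≤ : ∀ {x} → i (i x) ≤ x
  ii≤ = reflexive (i-involutive _)

  dom+-sym : ∀ {x y} → (x , y) ∈ dom+ → (y , x) ∈ dom+
  dom+-sym p = trans ≤ii (i-antitone p)

  +-increasingʳ : ∀ {x y} (p : (x , y) ∈ dom+) → y ≤ x + y [ p ]
  +-increasingʳ p = trans (+-increasing (dom+-sym p)) (reflexive (+-comm (dom+-sym p) p))

  +-comm-≤ : ∀ {x y} (p : (x , y) ∈ dom+) (q : (y , x) ∈ dom+) → x + y [ p ] ≤ y + x [ q ]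
  +-comm-≤ p q = reflexive (+-comm p q)

  +-swap⁺ : ∀ {x y z} (p : (i x , y) ∈ dom+) (q : (z , y) ∈ dom+) → i x + y [ p ] ≤ i z → z + y [ q ] ≤ x
  +-swap⁺ p q = Bundles.Equivalence.to (+-i-swap p q)

  +-swap⁻ : ∀ {x y z} (p : (i x , y) ∈ dom+) (q : (z , y) ∈ dom+) → z + y [ q ] ≤ x → i x + y [ p ] ≤ i z
  +-swap⁻ p q = Bundles.Equivalence.from (+-i-swap p q)

  infix  4 _≈ᶜ_
  infixl 6 _⊕ᶜ_

  record _≈ᶜ_ (U V : ClopenDownSet) : Set ℓ where
    constructor _,_
    field
      to   : (U ∋_) ⊆ (V ∋_)
      from : (V ∋_) ⊆ (U ∋_)

  open _≈ᶜ_

  ≈ᶜ-refl : ∀ {U} → U ≈ᶜ U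
  ≈ᶜ-refl = (λ u → u) , λ u → u

  ≈ᶜ-trans : ∀ {U V W} → U ≈ᶜ V → V ≈ᶜ W → U ≈ᶜ W
  ≈ᶜ-trans (p , p′) (q , q′) = (λ u → q (p u)) , λ w → p′ (q′ w)

  ≈ᶜ-sym : ∀ {U V} → U ≈ᶜ V → V ≈ᶜ U
  ≈ᶜ-sym (p , q) = q , p

  ∌⇒≈ᶜ : ∀ U V → (∀ {x} → U ∌ x → V ∌ x) → (∀ {x} → V ∌ x → U ∌ x) → U ≈ᶜ V
  ∌⇒≈ᶜ U V f g = (λ u → stable λ n → g n u) , (λ v → stable λ n → f n v)

  _⊕ᶜ_ : ClopenDownSet → ClopenDownSet → ClopenDownSet
  U ⊕ᶜ V = ~ᶜ (~ᶜ U ⊖ᶜ V)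

  Sum : ClopenDownSet → ClopenDownSet → Pred Carrier ℓ
  Sum U V x = ∃₂ λ y z → Σ[ p ∈ (y , z) ∈ dom+ ] U ∌ y × V ∌ z × y + z [ p ] ≤ x

  ∌⊕⁻ : ∀ U V {x} → U ⊕ᶜ V ∌ x → Sum U V x
  ∌⊕⁻ U V {x} n =
    let z , p , z∉V , u = ⌊⌋⁻ (stable λ m → n (⌊⌋⁺ m))
        -- By `+-i-swap` this is the largest `y` with `y + z ≤ x`.
        y = i (i x + z [ p ])
        q = trans (+-increasingʳ p) ≤ii
    in y , z , q , ⌊⌋⁻ u , z∉V , +-swap⁺ p q ≤ii

  ∌⊕⁺ : ∀ U V {x} → Sum U V x → U ⊕ᶜ V ∌ x
  ∌⊕⁺ U V {x} (y , z , q , y∉U , z∉V , y+z≤x) u = ⌊⌋⁻ u (⌊⌋⁺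
    (z , p , z∉V , ⌊⌋⁺ (isUp-∁ U (trans ≤ii (i-antitone (+-swap⁻ p q y+z≤x))) y∉U)))
    where
    p : (i x , z) ∈ dom+
    p = trans (+-increasingʳ q) (trans y+z≤x ≤ii)

  Sum⇒≈ : ∀ {U V U′ V′} → Sum U V ⊆ Sum U′ V′ → Sum U′ V′ ⊆ Sum U V → U ⊕ᶜ V ≈ᶜ U′ ⊕ᶜ V′
  Sum⇒≈ {U} {V} {U′} {V′} f g = ∌⇒≈ᶜ (U ⊕ᶜ V) (U′ ⊕ᶜ V′)
    (λ n → ∌⊕⁺ U′ V′ (f (∌⊕⁻ U V n))) (λ n → ∌⊕⁺ U V (g (∌⊕⁻ U′ V′ n)))

  ⊕-cong : ∀ {U U′ V V′} → U ≈ᶜ U′ → V ≈ᶜ V′ → U ⊕ᶜ V ≈ᶜ U′ ⊕ᶜ V′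
  ⊕-cong {U} {U′} {V} {V′} (u , u′) (v , v′) = Sum⇒≈ {U} {V} {U′} {V′}
    (λ (y , z , p , y∉ , z∉ , le) → y , z , p , (λ m → y∉ (u′ m)) , (λ m → z∉ (v′ m)) , le)
    (λ (y , z , p , y∉ , z∉ , le) → y , z , p , (λ m → y∉ (u m)) , (λ m → z∉ (v m)) , le)

  Sum-comm : ∀ U V → Sum U V ⊆ Sum V U
  Sum-comm U V (y , z , p , y∉ , z∉ , le) =
    z , y , dom+-sym p , z∉ , y∉ , trans (+-comm-≤ (dom+-sym p) p) le

  ⊕-comm : ∀ U V → U ⊕ᶜ V ≈ᶜ V ⊕ᶜ U
  ⊕-comm U V = Sum⇒≈ {U} {V} {V} {U} (Sum-comm U V) (Sum-comm V U)

  -- The axiom `+-assoc` applies only when all four sums are defined. That `y + (z + w)` is defined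
  -- comes from `+-i-swap`, which turns `y + z ≤ i w` into `w + z ≤ i y`.
  Sum-assoc : ∀ U V W → Sum (U ⊕ᶜ V) W ⊆ Sum U (V ⊕ᶜ W)
  Sum-assoc U V W {x} (t , w , tw , t∉ , w∉W , t+w≤x) =
    let y , z , yz , y∉U , z∉V , y+z≤t = ∌⊕⁻ U V t∉
        [yz]w : (y + z [ yz ] , w) ∈ dom+
        [yz]w = trans tw (i-antitone y+z≤t)
        zw : (z , w) ∈ dom+
        zw = trans [yz]w (i-antitone (+-increasingʳ yz))
        wz = dom+-sym zw
        iiy,z : (i (i y) , z) ∈ dom+
        iiy,z = trans yz (i-antitone ii≤)
        y[zw] : (y , z + w [ zw ]) ∈ dom+
        y[zw] = trans (+-comm-≤ zw wz)
          (+-swap⁺ iiy,z wz (trans (+-monoˡ iiy,z yz ii≤) (dom+-sym [yz]w)))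
    in y , z + w [ zw ] , y[zw] , y∉U , ∌⊕⁺ V W (z , w , zw , z∉V , w∉W , refl) ,
       trans (reflexive (+-assoc zw y[zw] yz [yz]w)) (trans (+-monoˡ [yz]w tw y+z≤t) t+w≤x)

  ⊕-assoc : ∀ U V W → (U ⊕ᶜ V) ⊕ᶜ W ≈ᶜ U ⊕ᶜ (V ⊕ᶜ W)
  -- The reverse inclusion is `Sum-assoc` for `W`, `V`, `U`, conjugated by commutativity.
  ⊕-assoc U V W = Sum⇒≈ {U ⊕ᶜ V} {W} {U} {V ⊕ᶜ W} (Sum-assoc U V W) λ s →
    Sum-comm W (U ⊕ᶜ V) (Sum⊆ {W} {V} {U} (Sum-assoc W V U (Sum-comm U (W ⊕ᶜ V) (Sum⊆ {U} {V} {W} s))))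
    where
    Sum⊆ : ∀ {U V W} → Sum U (V ⊕ᶜ W) ⊆ Sum U (W ⊕ᶜ V)
    Sum⊆ {U} {V} {W} (y , z , p , y∉ , z∉ , le) =
      y , z , p , y∉ , (λ m → z∉ (to (⊕-comm W V) m)) , le

  -- The upper adjoint at `x` supplies a zero local to `x`, a point `w` with `x + w ≤ x`; like every
  -- point it is outside `∅`.
  ⊕-identityˡ : ∀ U → ∅ ⊕ᶜ U ≈ᶜ U
  ⊕-identityˡ U = ∌⇒≈ᶜ (∅ ⊕ᶜ U) U
    (λ n → let y , z , p , _ , z∉U , le = ∌⊕⁻ ∅ U n in isUp-∁ U (trans (+-increasingʳ p) le) z∉U)
    λ {x} x∉U → let w , q , x+w≤x , _ = L♯-bound refl in
      ∌⊕⁺ ∅ U (w , x , dom+-sym q , (λ e → lower (⌊⌋⁻ e)) , x∉U , trans (+-comm-≤ (dom+-sym q) q) x+w≤x)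

  ~-cong : ∀ {U V} → U ≈ᶜ V → ~ᶜ U ≈ᶜ ~ᶜ V
  ~-cong (f , g) = (λ u → ⌊⌋⁺ λ v → ⌊⌋⁻ u (g v)) , (λ v → ⌊⌋⁺ λ u → ⌊⌋⁻ v (f u))

  ~-involutive : ∀ U → ~ᶜ ~ᶜ U ≈ᶜ U
  ~-involutive U = (λ n → isDown U ≤ii (stable λ m → ⌊⌋⁻ n (⌊⌋⁺ m))) ,
                   (λ u → ⌊⌋⁺ λ n → ⌊⌋⁻ n (isDown U ii≤ u))

  ⊕-zeroʳ : ∀ U → U ⊕ᶜ ~ᶜ ∅ ≈ᶜ ~ᶜ ∅
  ⊕-zeroʳ U = ∌⇒≈ᶜ (U ⊕ᶜ ~ᶜ ∅) (~ᶜ ∅)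
    (λ n → let _ , _ , _ , _ , z∉ , _ = ∌⊕⁻ U (~ᶜ ∅) n in contradiction (⌊⌋⁺ λ e → lower (⌊⌋⁻ e)) z∉)
    (λ n → contradiction (⌊⌋⁺ λ e → lower (⌊⌋⁻ e)) n)

  ⊖ᶜ-cong : ∀ {U U′ V V′} → U ≈ᶜ U′ → V ≈ᶜ V′ → U ⊖ᶜ V ≈ᶜ U′ ⊖ᶜ V′
  ⊖ᶜ-cong (u , u′) (v , v′) =
    (λ d → let z , p , n , m = ⌊⌋⁻ d in ⌊⌋⁺ (z , p , (λ k → n (v′ k)) , u m)) ,
    (λ d → let z , p , n , m = ⌊⌋⁻ d in ⌊⌋⁺ (z , p , (λ k → n (v k)) , u′ m))

  ⊖≈⊖ᶜ : ∀ U V → ~ᶜ (~ᶜ U ⊕ᶜ V) ≈ᶜ U ⊖ᶜ V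
  ⊖≈⊖ᶜ U V = ≈ᶜ-trans (~-involutive (~ᶜ ~ᶜ U ⊖ᶜ V)) (⊖ᶜ-cong (~-involutive U) ≈ᶜ-refl)

  -- For a point outside both sets, the existential form of the outer difference would demand an
  -- explicit summand. The universal form `Difference⋆` reduces the task to one `y` in `V` at a
  -- time, where `⋆-reflect` applies.
  ⊖⊕≈∪ : ∀ U V → (U ⊖ᶜ V) ⊕ᶜ V ≈ᶜ U ∪ᶜ V
  ⊖⊕≈∪ U V = ∌⇒≈ᶜ ((U ⊖ᶜ V) ⊕ᶜ V) (U ∪ᶜ V) ⊆∌ ⊇∌
    where
    W = U ⊖ᶜ V
    ⊆∌ : ∀ {x} → W ⊕ᶜ V ∌ x → U ∪ᶜ V ∌ x
    ⊆∌ n m =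
      let y , z , p , y∉W , z∉V , y+z≤x = ∌⊕⁻ W V n
      in [ (λ x∈U → y∉W (⌊⌋⁺ (z , p , z∉V , isDown U y+z≤x x∈U)))
         , (λ x∈V → z∉V (isDown V (trans (+-increasingʳ p) y+z≤x) x∈V)) ]′ (⌊⌋⁻ m)
    ⊇∌ : ∀ {x} → U ∪ᶜ V ∌ x → W ⊕ᶜ V ∌ x
    ⊇∌ {x} n m = ⌊⌋⁻ m (⌊⌋⁺ (Difference⋆⊆ (~ᶜ W) V
      (⌊⌋⁺ (λ iix∈W → x∉U (isDown U ≤ii (proj₁ (Difference⊆⋆ U V (⌊⌋⁻ iix∈W))))) ,
       λ y y∈V → let p : (i x , y) ∈ dom⋆
                     p iix≤y = x∉V (isDown V (trans ≤ii iix≤y) y∈V)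
                 in p , ⌊⌋⁺ (star y y∈V p))))
      where
      x∉U : U ∌ x
      x∉U u = n (⌊⌋⁺ (inj₁ u))
      x∉V : V ∌ x
      x∉V v = n (⌊⌋⁺ (inj₂ v))
      -- A witness z of i (i x ⋆ y) ∈ U ⊖ V gives i (t + z) ≤ i x by condition (v), so x ≤ t + z ∈ U.
      star : ∀ y → V ∋ y → (p : (i x , y) ∈ dom⋆) → W ∌ i (i x ⋆ y [ p ])
      star y y∈V p w =
        let z , q , z∉V , t+z∈U = ⌊⌋⁻ w
            t = i (i x ⋆ y [ p ])
            r : (i (t + z [ q ]) , z) ∈ dom+
            r = trans (+-increasingʳ q) ≤ii
            i[t+z]≤ix = ⋆-reflect p (z , (λ z≤y → z∉V (isDown V z≤y y∈V)) , r , +-swap⁺ q r ≤ii)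
        in x∉U (isDown U (trans ≤ii (trans (i-antitone i[t+z]≤ix) ii≤)) t+z∈U)

  ⊕-isCommutativeMonoid : IsCommutativeMonoid _≈ᶜ_ _⊕ᶜ_ ∅
  ⊕-isCommutativeMonoid = isCommutativeMonoidˡ record
    { isSemigroup = record
      { isMagma = record
        { isEquivalence = record { refl = ≈ᶜ-refl ; sym = ≈ᶜ-sym ; trans = ≈ᶜ-trans }
        ; ∙-cong        = ⊕-cong }
      ; assoc = ⊕-assoc }
    ; identityˡ = ⊕-identityˡ
    ; comm      = ⊕-comm
    }

  ∪-comm : ∀ U V → U ∪ᶜ V ≈ᶜ V ∪ᶜ U
  ∪-comm U V = (λ m → ⌊⌋⁺ (Sum.swap (⌊⌋⁻ m))) , (λ m → ⌊⌋⁺ (Sum.swap (⌊⌋⁻ m)))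

  ∨≈∪ : ∀ U V → ~ᶜ (~ᶜ U ⊕ᶜ V) ⊕ᶜ V ≈ᶜ U ∪ᶜ V
  ∨≈∪ U V = ≈ᶜ-trans (⊕-cong (⊖≈⊖ᶜ U V) ≈ᶜ-refl) (⊖⊕≈∪ U V)

  clopenAlgebra : MVAlgebra ℓ
  clopenAlgebra = record
    { Carrier               = ClopenDownSet
    ; _≈_                   = _≈ᶜ_
    ; _⊕_                   = _⊕ᶜ_
    ; ~_                    = ~ᶜ_
    ; 0#                    = ∅
    ; ⊕-isCommutativeMonoid = ⊕-isCommutativeMonoid
    ; ~-cong                = ~-cong
    ; ~-involutive          = ~-involutive
    ; ⊕-zeroʳ               = ⊕-zeroʳ
    ; łukasiewicz           = λ U V →
        ≈ᶜ-trans (∨≈∪ U V) (≈ᶜ-trans (∪-comm U V) (≈ᶜ-sym (∨≈∪ V U)))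
    }

  open MVOrder clopenAlgebra using (_∨_; _∧_; ≤⇒∨≈; ∧-greatest) renaming (_≤_ to _≤ᶜ_)

  ≤ᶜ⇒⊆ : ∀ {U V} → U ≤ᶜ V → (U ∋_) ⊆ (V ∋_)
  ≤ᶜ⇒⊆ {U} {V} U≤V {x} u =
    to (≤⇒∨≈ {U} {V} U≤V) (from (∨≈∪ U V) (⌊⌋⁺ (inj₁ u)))

  ⊆⇒≤ᶜ : ∀ {U V} → (U ∋_) ⊆ (V ∋_) → U ≤ᶜ V
  ⊆⇒≤ᶜ {U} {V} U⊆V = (λ _ → ⌊⌋⁺ λ e → lower (⌊⌋⁻ e)) , λ {x} _ → stable λ n →
    let y , z , p , y∉ , z∉V , le = ∌⊕⁻ (~ᶜ U) V n
        iy∈U = stable λ m → y∉ (⌊⌋⁺ m)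
    in z∉V (U⊆V (isDown U p iy∈U))

  ∋∨⁻ : ∀ U V {x} → (U ∨ V) ∋ x → U ∋ x ⊎ V ∋ x
  ∋∨⁻ U V m = ⌊⌋⁻ (to (∨≈∪ U V) m)

  ∋∧⁺ : ∀ U V {x} → U ∋ x → V ∋ x → (U ∧ V) ∋ x
  ∋∧⁺ U V u v = ≤ᶜ⇒⊆ {U ∩ᶜ V} {U ∧ V} (∧-greatest {U} {V} {U ∩ᶜ V}
    (⊆⇒≤ᶜ {U ∩ᶜ V} {U} λ m → proj₁ (⌊⌋⁻ m)) (⊆⇒≤ᶜ {U ∩ᶜ V} {V} λ m → proj₂ (⌊⌋⁻ m))) (⌊⌋⁺ (u , v))

-- Prime lattice ideals of an MV-algebra

module PrimeIdeals (ax : Axioms) {ℓ} (A : MVAlgebra ℓ) where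
  open MVAlgebra A using (Carrier; _⊕_; ~_; 0#; 1#; identityʳ; sym; ⊕-zeroʳ)
  open MVOrder A
  open Classical ax ℓ

  record IsPrimeIdeal {p} (I : Pred Carrier p) : Set (ℓ ⊔ p) where
    field
      0∈    : 0# ∈ I
      1∉    : 1# ∉ I
      down  : ∀ {a b} → a ≤ b → b ∈ I → a ∈ I
      ∨∈    : ∀ {a b} → a ∈ I → b ∈ I → a ∨ b ∈ I
      prime : ∀ {a b} → a ∧ b ∈ I → a ∈ I ⊎ b ∈ I

    ∧∉ : ∀ {a b} → a ∉ I → b ∉ I → a ∧ b ∉ I
    ∧∉ a∉ b∉ m = [ a∉ , b∉ ]′ (prime m)

    up : ∀ {a b} → a ≤ b → a ∉ I → b ∉ I
    up a≤b a∉ b∈ = a∉ (down a≤b b∈)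

  record PrimeIdeal : Set ℓ where
    field
      member       : Carrier → Bool
      isPrimeIdeal : IsPrimeIdeal (λ a → True (member a))

    open IsPrimeIdeal isPrimeIdeal public

  open PrimeIdeal public using (0∈; 1∉; down; ∨∈; prime; ∧∉; up)

  infix 4 _∈ᴵ_ _∉ᴵ_ _⊑_

  _∈ᴵ_ _∉ᴵ_ : Carrier → PrimeIdeal → Set ℓ
  a ∈ᴵ x = True (PrimeIdeal.member x a)
  a ∉ᴵ x = ¬ a ∈ᴵ x

  _⊑_ : PrimeIdeal → PrimeIdeal → Set ℓ
  x ⊑ y = ∀ a → a ∈ᴵ x → a ∈ᴵ y

  ⋢⇒∈∉ : ∀ x y → ¬ x ⊑ y → ∃ λ a → a ∈ᴵ x × a ∉ᴵ y
  ⋢⇒∈∉ _ _ n = stable λ none → n λ a m → stable λ k → none (a , m , k)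

  primeIdeal : ∀ {p} {I : Pred Carrier p} → IsPrimeIdeal I → PrimeIdeal
  primeIdeal {I = I} p = record
    { member = λ a → ⌊ a ∈ I ⌋
    ; isPrimeIdeal = record
      { 0∈    = ⌊⌋⁺ p.0∈
      ; 1∉    = λ m → p.1∉ (⌊⌋⁻ m)
      ; down  = λ a≤b m → ⌊⌋⁺ (p.down a≤b (⌊⌋⁻ m))
      ; ∨∈    = λ m n → ⌊⌋⁺ (p.∨∈ (⌊⌋⁻ m) (⌊⌋⁻ n))
      ; prime = λ m → [ (λ n → inj₁ (⌊⌋⁺ n)) , (λ n → inj₂ (⌊⌋⁺ n)) ]′ (p.prime (⌊⌋⁻ m)) } }
    where module p = IsPrimeIdeal p

  neither : ∀ {p q} {P : Set p} {Q : Set q} → (¬ P → ¬ Q → P ⊎ Q) → P ⊎ Q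
  neither f = stable λ n → n (f (λ p → n (inj₁ p)) (λ q → n (inj₂ q)))

  infix 9 ~ᴵ_

  opaque
    ~ᴵ_ : PrimeIdeal → PrimeIdeal
    ~ᴵ x = primeIdeal {I = λ a → ~ a ∉ᴵ x} record
      { 0∈    = 1∉ x
      ; 1∉    = λ n → n (down x (≤-reflexive ~1≈0) (0∈ x))
      ; down  = λ a≤b → up x (~-antitone a≤b)
      ; ∨∈    = λ n m → up x (~∧~≤~∨ _ _) (∧∉ x n m)
      ; prime = λ n → neither λ a∉ b∉ →
          ⊥-elim (n (down x (~∧≤~∨~ _ _) (∨∈ x (stable b∉) (stable a∉))))
      }

    ∈~⁺ : ∀ {x a} → ~ a ∉ᴵ x → a ∈ᴵ ~ᴵ x
    ∈~⁺ = ⌊⌋⁺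

    ∈~⁻ : ∀ {x a} → a ∈ᴵ ~ᴵ x → ~ a ∉ᴵ x
    ∈~⁻ = ⌊⌋⁻

  opaque
    -- The domain condition secures properness: `1# ⊖ b` is `~ b`, which is outside `x` for every
    -- `b` in `y`.
    sum : ∀ x y → y ⊑ ~ᴵ x → PrimeIdeal
    sum x y y≤ix = primeIdeal {I = λ c → ∃ λ b → b ∈ᴵ y × c ⊖ b ∈ᴵ x} record
      { 0∈    = 0# , 0∈ y , down x (x⊖y≤x _ _) (0∈ x)
      ; 1∉    = λ (b , b∈y , m) → ∈~⁻ (y≤ix b b∈y) (down x (≤-reflexive (sym (1⊖x≈~x b))) m)
      ; down  = λ a≤c (b , b∈y , m) → b , b∈y , down x (⊖-monoˡ b a≤c) m
      ; ∨∈    = λ (b , b∈y , m) (b′ , b′∈y , m′) → b ∨ b′ , ∨∈ y b∈y b′∈y ,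
          down x (≤-trans (∨-⊖-distrib _ _ _) (∨-mono (⊖-antiʳ _ (x≤x∨y b b′)) (⊖-antiʳ _ (y≤x∨y b b′))))
                 (∨∈ x m m′)
      ; prime = λ (b , b∈y , m) → [ (λ n → inj₁ (b , b∈y , n)) , (λ n → inj₂ (b , b∈y , n)) ]′
          (prime x (down x (∧-⊖-distrib _ _ b) m))
      }

    ∈sum⁺ : ∀ {x y c} p b → b ∈ᴵ y → c ⊖ b ∈ᴵ x → c ∈ᴵ sum x y p
    ∈sum⁺ p b b∈ m = ⌊⌋⁺ (b , b∈ , m)

    ∈sum⁻ : ∀ {x y c} p → c ∈ᴵ sum x y p → ∃ λ b → b ∈ᴵ y × c ⊖ b ∈ᴵ x
    ∈sum⁻ p m = ⌊⌋⁻ m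

  opaque
    -- The largest y with sum x y disjoint from C.
    residual : ∀ {p} (C : Pred Carrier p) x → ∃ C → (∀ c → c ∈ C → c ∉ᴵ x) → PrimeIdeal
    residual C x (c₀ , c₀∈) C∩x=∅ = primeIdeal {I = λ d → ∀ c → c ∈ C → c ⊖ d ∉ᴵ x} record
      { 0∈    = λ c c∈ → up x (≤-respʳ (identityʳ _) (≤⊖⊕ _ 0#)) (C∩x=∅ c c∈)
      ; 1∉    = λ n → n c₀ c₀∈ (down x (≤-reflexive (x⊖1≈0 c₀)) (0∈ x))
      ; down  = λ a≤b n c c∈ → up x (⊖-antiʳ _ a≤b) (n c c∈)
      ; ∨∈    = λ n m c c∈ → up x (⊖-∨-distrib _ _ _) (∧∉ x (n c c∈) (m c c∈))
      -- An arbitrary `C` is not closed under meets or joins, so the counterexamples `c` and `d`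
      -- cannot be merged into one; `⊖-interchange` compares them crosswise.
      ; prime = λ {a} {b} n → neither λ a∉ b∉ →
          let c , c∈ , c⊖a∈ = counterexample a∉
              d , d∈ , d⊖b∈ = counterexample b∉
          in ⊥-elim (∧∉ x (λ m → n c c∈ (down x (⊖-∧-distrib _ _ _) (∨∈ x c⊖a∈ m)))
                          (λ m → n d d∈ (down x (⊖-∧-distrib _ _ _) (∨∈ x m d⊖b∈)))
                          (down x (⊖-interchange c d a b) (∨∈ x c⊖a∈ d⊖b∈)))
      }
      where
      counterexample : ∀ {d} → ¬ (∀ c → c ∈ C → c ⊖ d ∉ᴵ x) → ∃ λ c → c ∈ C × c ⊖ d ∈ᴵ x
      counterexample n = stable λ none → n λ c c∈ m → none (c , c∈ , m)

    ∈residual⁺ : ∀ {p} {C : Pred Carrier p} {x ne disj d} → (∀ c → c ∈ C → c ⊖ d ∉ᴵ x) →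
                 d ∈ᴵ residual C x ne disj
    ∈residual⁺ = ⌊⌋⁺

    ∈residual⁻ : ∀ {p} {C : Pred Carrier p} {x ne disj d} → d ∈ᴵ residual C x ne disj →
                 ∀ c → c ∈ C → c ⊖ d ∉ᴵ x
    ∈residual⁻ = ⌊⌋⁻

    residual-dom : ∀ {p} (C : Pred Carrier p) x ne disj → residual C x ne disj ⊑ ~ᴵ x
    residual-dom C x (c , c∈) disj d m = ∈~⁺ (up x (x⊖y≤~y c d) (⌊⌋⁻ m c c∈))

  opaque
    star : ∀ x y → ¬ ~ᴵ x ⊑ y → PrimeIdeal
    star x y ix≰y = primeIdeal {I = λ c → ∀ b → b ∉ᴵ y → c ⊖ b ∈ᴵ x} record
      { 0∈    = λ _ _ → down x (x⊖y≤x _ _) (0∈ x)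
      ; 1∉    = λ n → ix≰y λ b b∈ → stable λ b∉ → ∈~⁻ b∈ (down x (≤-reflexive (sym (1⊖x≈~x b))) (n b b∉))
      ; down  = λ a≤c n b b∉ → down x (⊖-monoˡ _ a≤c) (n b b∉)
      ; ∨∈    = λ n m b b∉ → down x (∨-⊖-distrib _ _ _) (∨∈ x (n b b∉) (m b b∉))
      ; prime = λ n → neither λ p q → ⊥-elim (
          let b , b∉ , m = counterexample p
              b′ , b′∉ , m′ = counterexample q
          in ∧∉ x m m′ (down x (≤-trans (∧-mono (⊖-antiʳ _ (x∧y≤x b b′)) (⊖-antiʳ _ (x∧y≤y b b′)))
                                        (∧-⊖-distrib _ _ _)) (n _ (∧∉ y b∉ b′∉))))
      }
      where
      counterexample : ∀ {c} → ¬ (∀ b → b ∉ᴵ y → c ⊖ b ∈ᴵ x) → ∃ λ b → b ∉ᴵ y × c ⊖ b ∉ᴵ x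
      counterexample n = stable λ none → n λ _ b∉ → stable λ m → none (_ , b∉ , m)

    ∈star⁺ : ∀ {x y c} p → (∀ b → b ∉ᴵ y → c ⊖ b ∈ᴵ x) → c ∈ᴵ star x y p
    ∈star⁺ p = ⌊⌋⁺

    ∈star⁻ : ∀ {x y c} p → c ∈ᴵ star x y p → ∀ b → b ∉ᴵ y → c ⊖ b ∈ᴵ x
    ∈star⁻ p = ⌊⌋⁻

    ∉star⁻ : ∀ {x y c} p → c ∉ᴵ star x y p → ∃ λ b → b ∉ᴵ y × c ⊖ b ∉ᴵ x
    ∉star⁻ p n = stable λ none → n (⌊⌋⁺ λ b b∉ → stable λ m → none (b , b∉ , m))

  opaque
    -- As `c ≤ (c ⊖ b) ⊕ b`, the sum of `x` and `w` lies in `z` as soon as `a ⊕ b` does for all `a`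
    -- in `x` and `b` in `w`. This constrains each `b` separately, so the admissible `b` form the
    -- largest `w`.
    adjoint : ∀ x z → x ⊑ z → PrimeIdeal
    adjoint x z x≤z = primeIdeal {I = λ b → ∀ a → a ∈ᴵ x → a ⊕ b ∈ᴵ z} record
      { 0∈    = λ _ m → down z (≤-reflexive (identityʳ _)) (x≤z _ m)
      ; 1∉    = λ n → 1∉ z (down z (≤-reflexive (sym (⊕-zeroʳ 0#))) (n 0# (0∈ x)))
      ; down  = λ b≤c n a m → down z (⊕-monoʳ _ b≤c) (n a m)
      ; ∨∈    = λ n n′ a m → down z (⊕-∨-distrib _ _ _) (∨∈ z (n a m) (n′ a m))
      ; prime = λ n → neither λ p q → ⊥-elim (
          let a , a∈ , m = counterexample p
              a′ , a′∈ , m′ = counterexample q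
          in ∧∉ z m m′ (down z (≤-trans (∧-mono (⊕-monoˡ _ (x≤x∨y a a′)) (⊕-monoˡ _ (y≤x∨y a a′)))
                                        (⊕-∧-distrib _ _ _)) (n _ (∨∈ x a∈ a′∈))))
      }
      where
      counterexample : ∀ {b} → ¬ (∀ a → a ∈ᴵ x → a ⊕ b ∈ᴵ z) → ∃ λ a → a ∈ᴵ x × a ⊕ b ∉ᴵ z
      counterexample n = stable λ none → n λ _ a∈ → stable λ m → none (_ , a∈ , m)

    ∈adjoint⁺ : ∀ {x z b} x≤z → (∀ a → a ∈ᴵ x → a ⊕ b ∈ᴵ z) → b ∈ᴵ adjoint x z x≤z
    ∈adjoint⁺ _ = ⌊⌋⁺

    ∈adjoint⁻ : ∀ {x z b} x≤z → b ∈ᴵ adjoint x z x≤z → ∀ a → a ∈ᴵ x → a ⊕ b ∈ᴵ z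
    ∈adjoint⁻ _ = ⌊⌋⁻

  join : List Carrier → Carrier
  join = foldr _∨_ 0#

  ∈⇒≤join : ∀ {c l} → c ∈ᴸ l → c ≤ join l
  ∈⇒≤join {l = _ ∷ l} (here ≡-refl) = x≤x∨y _ (join l)
  ∈⇒≤join {l = d ∷ l} (there i)     = ≤-trans (∈⇒≤join i) (y≤x∨y d (join l))

  join-least : ∀ {l c} → (∀ {d} → d ∈ᴸ l → d ≤ c) → join l ≤ c
  join-least {[]}    _ = 0≤ _
  join-least {d ∷ l} h = ∨-least (h (here ≡-refl)) (join-least λ i → h (there i))

  opaque
    -- The property `P l` says that the ideal generated by `b` and `l` avoids `a`. Maximality then
    -- reads in two ways: `close` puts into `M` whatever is generated by `b` and a finite part of
    -- `M`, and `refute` shows that an element outside `M` would generate `a` together with such a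
    -- part.
    prime-ideal-theorem : ∀ {a b} → ¬ a ≤ b → ∃ λ x → b ∈ᴵ x × a ∉ᴵ x
    prime-ideal-theorem {a} {b} a≰b = x , b∈ , a∉
      where
      P : List Carrier → Set ℓ
      P l = ¬ a ≤ b ∨ join l
      open Tukey P
        (λ l⊆l′ n a≤ → n (≤-trans a≤ (∨-mono ≤-refl (join-least λ i → ∈⇒≤join (l⊆l′ i)))))
        (λ a≤ → a≰b (≤-trans a≤ (∨-least ≤-refl (0≤ b))))
        using (M; M-good; M-maximal; _∋_)
      close : ∀ {c l} → All (M ∋_) l → c ≤ b ∨ join l → M ∋ c
      close {c} {l} ms c≤ = M-maximal c λ {l′} ms′ a≤ → M-good (AllP.++⁺ ms ms′)
        (≤-trans a≤ (∨-least (x≤x∨y _ _) (∨-least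
          (≤-trans c≤ (∨-mono ≤-refl (join-least λ i → ∈⇒≤join (SubsetP.xs⊆xs++ys l l′ i))))
          (≤-trans (join-least λ i → ∈⇒≤join (SubsetP.xs⊆ys++xs l′ l i)) (y≤x∨y _ _)))))
      refute : ∀ {c} → ¬ M ∋ c → ∃ λ l → All (M ∋_) l × a ≤ (b ∨ join l) ∨ c
      refute {c} c∉ = stable λ none → c∉ (M-maximal c λ {l} ms a≤ → none (l , ms , ≤-trans a≤
        (∨-least (≤-trans (x≤x∨y _ _) (x≤x∨y _ _))
          (∨-least (y≤x∨y _ c) (≤-trans (y≤x∨y _ _) (x≤x∨y _ _))))))
      a∉ : ¬ M ∋ a
      a∉ a∈ = M-good (a∈ ∷ []) (≤-trans (x≤x∨y a 0#) (y≤x∨y b _))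
      b∈ : M ∋ b
      b∈ = close [] (x≤x∨y b 0#)
      x : PrimeIdeal
      x = record
        { member = M
        ; isPrimeIdeal = record
          { 0∈    = close [] (0≤ _)
          ; 1∉    = λ m → a∉ (close (m ∷ []) (≤-trans (≤1 a) (≤-trans (x≤x∨y 1# 0#) (y≤x∨y b _))))
          ; down  = λ {c} {d} c≤d m → close (m ∷ [])
              (≤-trans c≤d (≤-trans (x≤x∨y d 0#) (y≤x∨y b _)))
          ; ∨∈    = λ {c} {d} m n → close (m ∷ n ∷ []) (≤-trans
              (∨-mono (≤-refl {c}) (x≤x∨y d 0#)) (y≤x∨y b _))
          ; prime = λ {c} {d} m → neither λ c∉ d∉ →
              let l  , ms  , p = refute c∉
                  l′ , ms′ , q = refute d∉
                  k = l ++ l′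
                  w = b ∨ join k
              -- Over the common part `k` both `c` and `d` generate `a`, so by distributivity
              -- `c ∧ d` does too, although it is in `M`.
              in ⊥-elim (M-good (m ∷ AllP.++⁺ ms ms′) (≤-trans
                (∨-∧-cut {a} {w} {c} {d}
                  (≤-trans p (∨-mono (∨-mono ≤-refl (join-least λ i → ∈⇒≤join (SubsetP.xs⊆xs++ys l l′ i))) ≤-refl))
                  (≤-trans q (∨-mono (∨-mono ≤-refl (join-least λ i → ∈⇒≤join (SubsetP.xs⊆ys++xs l′ l i))) ≤-refl)))
                (∨-least (∨-mono ≤-refl (y≤x∨y _ _)) (≤-trans (x≤x∨y _ _) (y≤x∨y b _)))))
          } }

-- The spectrum as an MV-space

module Spectrum (ax : Axioms)
                {ℓ} (A : MVAlgebra ℓ) where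
  open MVAlgebra A using (Carrier; _⊕_; ~_; 0#; 1#; comm; refl; sym; trans; ~-involutive)
  open MVOrder A
  open Classical ax ℓ
  open PrimeIdeals ax A

  infix 4 _≋_

  _≋_ : PrimeIdeal → PrimeIdeal → Set ℓ
  x ≋ y = x ⊑ y × y ⊑ x

  ⊑-poset : Poset ℓ ℓ ℓ
  ⊑-poset = record
    { Carrier = PrimeIdeal
    ; _≈_     = _≋_
    ; _≤_     = _⊑_
    ; isPartialOrder = record
      { isPreorder = record
        { isEquivalence = record
          { refl  = (λ _ m → m) , (λ _ m → m)
          ; sym   = λ (p , q) → q , p
          ; trans = λ (p , q) (p′ , q′) → (λ a m → p′ a (p a m)) , (λ a m → q a (q′ a m)) }
        ; reflexive = proj₁
        ; trans     = λ p q a m → q a (p a m) }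
      ; antisym = _,_ } }

  -- A single condition of each kind suffices for a basic open set, because joins and meets absorb
  -- finite intersections.
  IsOpen : Pred (Pred PrimeIdeal ℓ) ℓ
  IsOpen U = ∀ x → x ∈ U → ∃₂ λ a b → a ∈ᴵ x × b ∉ᴵ x × (∀ {y} → a ∈ᴵ y → b ∉ᴵ y → y ∈ U)

  topology : Topology (Poset.Eq.setoid ⊑-poset) ℓ
  topology = record
    { IsOpen      = IsOpen
    ; isOpen-resp = λ (U⊆V , V⊆U) o x v → let a , b , a∈ , b∉ , sub = o x (V⊆U v) in
                    a , b , a∈ , b∉ , λ m n → U⊆V (sub m n)
    ; respects    = λ o (x⊑y , y⊑x) u → let a , b , a∈ , b∉ , sub = o _ u in
                    sub (x⊑y a a∈) λ m → b∉ (y⊑x b m)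
    ; whole       = λ x _ → 0# , 1# , 0∈ x , 1∉ x , _
    ; ∩-open      = λ o o′ x (u , v) →
                    let a , b , a∈ , b∉ , sub = o x u
                        a′ , b′ , a′∈ , b′∉ , sub′ = o′ x v
                    in a ∨ a′ , b ∧ b′ , ∨∈ x a∈ a′∈ , ∧∉ x b∉ b′∉ , λ {y} m n →
                       sub (down y (x≤x∨y a a′) m) (up y (x∧y≤x b b′) n) ,
                       sub′ (down y (y≤x∨y a a′) m) (up y (x∧y≤y b b′) n)
    ; ⋃-open      = λ o x (i , u) → let a , b , a∈ , b∉ , sub = o i x u in
                    a , b , a∈ , b∉ , λ m n → i , sub m n
    }

  ∈-open : ∀ a → (λ x → a ∈ᴵ x) ∈ IsOpen
  ∈-open a x m = a , 1# , m , 1∉ x , λ m _ → m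

  ∉-open : ∀ a → (λ x → a ∉ᴵ x) ∈ IsOpen
  ∉-open a x n = 0# , a , 0∈ x , n , λ _ n → n

  ∁∉-open : ∀ a → ∁ (λ x → a ∉ᴵ x) ∈ IsOpen
  ∁∉-open a x ¬n = a , 1# , stable ¬n , 1∉ x , λ m _ n → n m

  opaque
    -- Tukey's lemma on consistent finite sets of conditions a ∈ x or a ∉ x, where consistent means
    -- not covered by finitely many members of the cover.
    spectrum-compact : Compact topology
    spectrum-compact {I} U oU cover = stable λ not-compact →
      let open Maximal not-compact in uncovered (cover point)
      where
      infix 4 _⊨_
      _⊨_ : PrimeIdeal → Bool × Carrier → Set ℓ
      x ⊨ (true  , a) = a ∈ᴵ x
      x ⊨ (false , a) = a ∉ᴵ x
      Covered : List (Bool × Carrier) → Set ℓ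
      Covered l = ∃ λ is → ∀ x → All (x ⊨_) l → Any (λ i → x ∈ U i) is
      module Maximal (not-compact : ¬ ∃ λ is → ∀ x → Any (λ i → x ∈ U i) is) where
        open Tukey (λ l → ¬ Covered l)
          (λ l⊆l′ n (is , c) → n (is , λ x sat → c x (AllP.anti-mono l⊆l′ sat)))
          (λ (is , c) → not-compact (is , λ x → c x []))
          using (M; M-good; M-maximal; _∋_)
        close : ∀ {e l} → All (M ∋_) l → (∀ x → All (x ⊨_) l → x ⊨ e) → M ∋ e
        close {e} {l} ms entails = M-maximal e λ {l′} ms′ (is , c) → M-good (AllP.++⁺ ms ms′)
          (is , λ x sat → c x (entails x (AllP.++⁻ˡ l sat) ∷ AllP.++⁻ʳ l sat))
        complete : ∀ a → ¬ M ∋ (true , a) → M ∋ (false , a)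
        complete a n = M-maximal _ λ {l} ms (is , c) → n (M-maximal _ λ {l′} ms′ (is′ , c′) →
          M-good (AllP.++⁺ ms ms′) (is ++ is′ , λ x sat → merge is c c′ x (AllP.++⁻ˡ l sat) (AllP.++⁻ʳ l sat)))
          where
          merge : ∀ {l l′} is {is′} → (∀ x → All (x ⊨_) ((false , a) ∷ l) → Any (λ i → x ∈ U i) is) →
                  (∀ x → All (x ⊨_) ((true , a) ∷ l′) → Any (λ i → x ∈ U i) is′) →
                  ∀ x → All (x ⊨_) l → All (x ⊨_) l′ → Any (λ i → x ∈ U i) (is ++ is′)
          merge is c c′ x sat sat′ with decide (a ∈ᴵ x)
          ... | yes m = AnyP.++⁺ʳ is (c′ x (m ∷ sat′))
          ... | no n  = AnyP.++⁺ˡ (c x (n ∷ sat))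
        -- Conditions satisfied by no point are covered by the empty list, so they cannot all be in
        -- `M`; this excludes violations of properness and primality.
        inconsistent : ∀ {l} → All (M ∋_) l → ¬ (∀ x → ¬ All (x ⊨_) l)
        inconsistent ms none = M-good ms ([] , λ x sat → contradiction sat (none x))
        point : PrimeIdeal
        point = record
          { member = λ a → M (true , a)
          ; isPrimeIdeal = record
            { 0∈    = close [] λ x _ → 0∈ x
            ; 1∉    = λ m → inconsistent (m ∷ []) λ { x (n ∷ []) → 1∉ x n }
            ; down  = λ a≤b m → close (m ∷ []) λ { x (n ∷ []) → down x a≤b n }
            ; ∨∈    = λ m m′ → close (m ∷ m′ ∷ []) λ { x (n ∷ n′ ∷ []) → ∨∈ x n n′ }
            ; prime = λ m → neither λ a∉ b∉ → ⊥-elim (inconsistent (m ∷ complete _ a∉ ∷ complete _ b∉ ∷ [])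
                λ { x (n ∷ p ∷ q ∷ []) → ∧∉ x p q n })
            } }
        uncovered : ¬ point ∈ ⋃ I U
        uncovered (i , u) = let a , b , a∈ , b∉ , sub = oU i point u in
          M-good (a∈ ∷ complete b b∉ ∷ []) (i ∷ [] , λ { x (p ∷ q ∷ []) → here (sub p q) })

  priestleySpace : PriestleySpace ℓ
  priestleySpace = record
    { poset     = ⊑-poset
    ; τ         = topology
    ; compact   = spectrum-compact
    ; separated = λ {x} {y} x⋢y → let a , a∈x , a∉y = ⋢⇒∈∉ x y x⋢y in
        (λ z → a ∉ᴵ z) , (∉-open a , ∁∉-open a) , (λ y⊑x n m → n (y⊑x a m)) , a∉y , λ n → n a∈x
    }

  open TopologyProperties ax topology

  opaque
    shrink-∈ : ∀ {W} → W ∈ IsOpen → W Respects _⊑_ → ∀ {x} → x ∈ W →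
               ∃ λ c → c ∈ᴵ x × (∀ {z} → c ∈ᴵ z → z ∈ W)
    shrink-∈ oW up-set {x} x∈W = shrink spectrum-compact (λ c z → c ∈ᴵ z) ∉-open
      (0# , 0∈) (λ a b → a ∨ b , (λ {z} m → down z (x≤x∨y a b) m , down z (y≤x∨y a b) m) ,
                                 λ {z} (m , n) → ∨∈ z m n)
      oW x λ {q} q∉W → ⋢⇒∈∉ x q λ x⊑q → q∉W (up-set x⊑q x∈W)

    shrink-∉ : ∀ {W} → W ∈ IsOpen → W Respects (λ x y → y ⊑ x) → ∀ {x} → x ∈ W →
               ∃ λ c → c ∉ᴵ x × (∀ {z} → c ∉ᴵ z → z ∈ W)
    shrink-∉ oW down-set {x} x∈W = shrink spectrum-compact (λ c z → c ∉ᴵ z) ∁∉-open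
      (1# , 1∉) (λ a b → a ∧ b , (λ {z} m → up z (x∧y≤x a b) m , up z (x∧y≤y a b) m) ,
                                 λ {z} (m , n) → ∧∉ z m n)
      oW x λ {q} q∉W → let c , c∈q , c∉x = ⋢⇒∈∉ q x λ q⊑x → q∉W (down-set q⊑x x∈W) in
                   c , c∉x , λ n → n c∈q

  open PriestleySpace priestleySpace using (setoid; τ)

  ~ᴵ-antitone : ∀ {x y} → x ⊑ y → ~ᴵ y ⊑ ~ᴵ x
  ~ᴵ-antitone x⊑y a m = ∈~⁺ λ n → ∈~⁻ m (x⊑y (~ a) n)

  ~ᴵ-func : Func setoid setoid
  ~ᴵ-func = record { to = ~ᴵ_ ; cong = λ (p , q) → ~ᴵ-antitone q , ~ᴵ-antitone p }

  ~ᴵ-continuous : Continuous τ τ ~ᴵ-func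
  ~ᴵ-continuous o x u =
    let a , b , a∈ , b∉ , sub = o (~ᴵ x) u
    in ~ b , ~ a , stable (λ n → b∉ (∈~⁺ n)) , ∈~⁻ a∈ , λ m n → sub (∈~⁺ n) λ k → ∈~⁻ k m

  sum-mono : ∀ {x y x′ y′} (p : y ⊑ ~ᴵ x) (p′ : y′ ⊑ ~ᴵ x′) → x ⊑ x′ → y ⊑ y′ → sum x y p ⊑ sum x′ y′ p′
  sum-mono p p′ x⊑x′ y⊑y′ c m = let b , b∈ , n = ∈sum⁻ p m in ∈sum⁺ p′ b (y⊑y′ b b∈) (x⊑x′ _ n)

  star-mono : ∀ {x y x′ y′} (p : ¬ ~ᴵ x ⊑ y) (p′ : ¬ ~ᴵ x′ ⊑ y′) → x ⊑ x′ → y ⊑ y′ →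
              star x y p ⊑ star x′ y′ p′
  star-mono p p′ x⊑x′ y⊑y′ c m = ∈star⁺ p′ λ b b∉ → x⊑x′ _ (∈star⁻ p m b λ k → b∉ (y⊑y′ b k))

  x⊑sum : ∀ {x y} (p : y ⊑ ~ᴵ x) → x ⊑ sum x y p
  x⊑sum {x} {y} p c m = ∈sum⁺ p 0# (0∈ y) (down x (x⊖y≤x c 0#) m)

  ⊕∈sum : ∀ {x y} (p : y ⊑ ~ᴵ x) {a b} → a ∈ᴵ x → b ∈ᴵ y → a ⊕ b ∈ᴵ sum x y p
  ⊕∈sum {x} p a∈ b∈ = ∈sum⁺ p _ b∈ (down x (⊕⊖≤ _ _) a∈)

  -- Incomparable sums would give `c ⊖ b` and `d ⊖ b′` in `x` with `c ⊖ b′` and `d ⊖ b` outside it,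
  -- which `⊖-interchange` and primality forbid.
  sum-total : ∀ {x y y′} (p : y ⊑ ~ᴵ x) (p′ : y′ ⊑ ~ᴵ x) →
              sum x y p ⊑ sum x y′ p′ ⊎ sum x y′ p′ ⊑ sum x y p
  sum-total {x} {y} {y′} p p′ = neither λ ⋢ ⋣ →
    let c , c∈ , c∉ = ⋢⇒∈∉ (sum x y p) (sum x y′ p′) ⋢
        d , d∈ , d∉ = ⋢⇒∈∉ (sum x y′ p′) (sum x y p) ⋣
        b , b∈ , c⊖b∈ = ∈sum⁻ p c∈
        b′ , b′∈ , d⊖b′∈ = ∈sum⁻ p′ d∈
    in ⊥-elim (∧∉ x (λ m → c∉ (∈sum⁺ p′ b′ b′∈ m)) (λ m → d∉ (∈sum⁺ p b b∈ m))
        (down x (⊖-interchange c d b b′) (∨∈ x c⊖b∈ d⊖b′∈)))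

  -- The residual of the singleton `a` is the largest `z` whose sum with `x` misses `a`, and it
  -- contains `b` exactly when `a ⊖ b` is outside `x`. Both the infimum property of `star` and the
  -- representation of `⊖` rest on this.
  difference-witness : ∀ {x} a b → a ⊖ b ∉ᴵ x →
                       ∃ λ z → Σ[ p ∈ z ⊑ ~ᴵ x ] b ∈ᴵ z × a ∉ᴵ sum x z p
  difference-witness {x} a b n =
    z , residual-dom (_≡ a) x _ _ , ∈residual⁺ (λ { _ ≡-refl → n }) ,
    λ m → let d , d∈ , k = ∈sum⁻ _ m in ∈residual⁻ d∈ a ≡-refl k
    where
    z : PrimeIdeal
    z = residual (_≡ a) x (a , ≡-refl) λ { _ ≡-refl → up x (x⊖y≤x a b) n }

  ⊖space : ⊖Space ℓ
  ⊖space = record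
    { space        = priestleySpace
    ; i-func       = ~ᴵ-func
    ; i-continuous = ~ᴵ-continuous
    ; i-antitone   = ~ᴵ-antitone
    ; +-func       = record
      { to   = λ ((x , y) , p) → sum x y p
      ; cong = λ { {(_ , p)} {(_ , p′)} ((q , r) , (q′ , r′)) → sum-mono p p′ q q′ , sum-mono p′ p r r′ } }
    ; ⋆-func       = record
      { to   = λ ((x , y) , p) → star x y p
      ; cong = λ { {(_ , p)} {(_ , p′)} ((q , r) , (q′ , r′)) → star-mono p p′ q q′ , star-mono p′ p r r′ } }
    -- The open set of pairs makes no reference to the domain: some `c` has its whole basic up-set
    -- inside `W`, and some `b` puts `c` into the sum.
    ; +-continuous = λ {W} (oW , up-set) →
        (λ (x , y) → ∃₂ λ b c → b ∈ᴵ y × c ⊖ b ∈ᴵ x × (∀ {z} → c ∈ᴵ z → z ∈ W)) ,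
        (λ (b , c , b∈ , m , sub) →
          (λ x → c ⊖ b ∈ᴵ x) , (λ y → b ∈ᴵ y) ,
          (∈-open (c ⊖ b) , λ x⊑x′ → x⊑x′ _) , (∈-open b , λ y⊑y′ → y⊑y′ _) , m , b∈ ,
          λ m b∈ → b , c , b∈ , m , sub) ,
        (λ { {(_ , p)} w → let c , c∈ , sub = shrink-∈ oW up-set w
                               b , b∈ , m = ∈sum⁻ p c∈
                           in b , c , b∈ , m , sub }) ,
        (λ { {(_ , p)} (b , c , b∈ , m , sub) → sub (∈sum⁺ p b b∈ m) })
    ; ⋆-continuous = λ {W} (oW , down-set) →
        (λ (x , y) → ∃₂ λ b c → b ∉ᴵ y × c ⊖ b ∉ᴵ x × (∀ {z} → c ∉ᴵ z → z ∈ W)) ,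
        (λ (b , c , b∉ , n , sub) →
          (λ x → c ⊖ b ∉ᴵ x) , (λ y → b ∉ᴵ y) ,
          (∉-open (c ⊖ b) , λ x′⊑x n m → n (x′⊑x _ m)) ,
          (∉-open b , λ y′⊑y n m → n (y′⊑y _ m)) , n , b∉ ,
          λ n b∉ → b , c , b∉ , n , sub) ,
        (λ { {(_ , p)} w → let c , c∉ , sub = shrink-∉ oW down-set w
                               b , b∉ , n = ∉star⁻ p c∉
                           in b , c , b∉ , n , sub }) ,
        (λ { {(_ , p)} (b , c , b∉ , n , sub) → sub λ m → n (∈star⁻ p m b b∉) })
    ; +-monoˡ      = λ p p′ x⊑x′ → sum-mono p p′ x⊑x′ (λ _ m → m)
    ; +-monoʳ      = λ p p′ → sum-mono p p′ (λ _ m → m)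
    ; ⋆-monoˡ      = λ p p′ x⊑x′ → star-mono p p′ x⊑x′ (λ _ m → m)
    ; ⋆-monoʳ      = λ p p′ → star-mono p p′ (λ _ m → m)
    ; ⋆-infimum    = λ {x} {y} p →
        (λ (w , q , w⋢y , _ , sum⊑v) c m → stable λ n → w⋢y λ b b∈w → stable λ b∉y →
           n (sum⊑v c (∈sum⁺ q b b∈w (∈star⁻ p m b b∉y)))) ,
        (λ lower c m → ∈star⁺ p λ b b∉y → stable λ n →
           let z , q , b∈z , c∉ = difference-witness c b n
           in c∉ (lower {sum x z q} (z , q , (λ z⊑y → b∉y (z⊑y b b∈z)) , (λ _ m → m) , (λ _ m → m)) c m))
    ; +-increasing = x⊑sum
    ; L-total      = λ x (_ , p) (_ , p′) → sum-total p p′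
    ; L-adj        = λ x →
        (λ (z , x⊑z) → adjoint x z x⊑z ,
          -- If `~ b` were in `x`, then `~ b ⊕ b`, which is `1#`, would be in `z`.
          λ b m → ∈~⁺ λ n → 1∉ z (down z (≤-reflexive (sym ≤-refl)) (∈adjoint⁻ x⊑z m (~ b) n))) ,
        λ { {(w , p)} {(z , x⊑z)} →
          (λ le b b∈w → ∈adjoint⁺ x⊑z λ a a∈x → le _ (⊕∈sum p a∈x b∈w)) ,
          (λ le c m → let b , b∈w , n = ∈sum⁻ p m in down z (≤⊖⊕ c b) (∈adjoint⁻ x⊑z (le b b∈w) _ n)) }
    }

  ~ᴵ-involutive : ∀ x → ~ᴵ ~ᴵ x ≋ x
  ~ᴵ-involutive x =
    (λ a m → down x (≤-reflexive (sym (~-involutive a))) (stable λ n → ∈~⁻ m (∈~⁺ n))) ,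
    (λ a m → ∈~⁺ λ n → ∈~⁻ n (down x (≤-reflexive (~-involutive a)) m))

  -- The two parts of `c` trade places: removing the witness `c ⊖ b` leaves `c ∧ b`, which is below
  -- `b`.
  sum-comm : ∀ {x y} (p : y ⊑ ~ᴵ x) (q : x ⊑ ~ᴵ y) → sum x y p ⊑ sum y x q
  sum-comm {x} {y} p q c m = let b , b∈ , n = ∈sum⁻ p m in
    ∈sum⁺ q (c ⊖ b) n (down y (⊖-swap ≤-refl) b∈)

  sum-assoc⁺ : ∀ {x y z} yz x[yz] xy [xy]z → sum x (sum y z yz) x[yz] ⊑ sum (sum x y xy) z [xy]z
  sum-assoc⁺ {x} yz x[yz] xy [xy]z c m with ∈sum⁻ x[yz] m
  ... | d , d∈ , c⊖d∈ with ∈sum⁻ yz d∈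
  ...   | e , e∈ , d⊖e∈ =
    ∈sum⁺ [xy]z e e∈ (∈sum⁺ xy (d ⊖ e) d⊖e∈ (down x (≤⊕⇒⊖≤ (⊖-triangle c d e)) c⊖d∈))

  sum-assoc⁻ : ∀ {x y z} yz x[yz] xy [xy]z → sum (sum x y xy) z [xy]z ⊑ sum x (sum y z yz) x[yz]
  sum-assoc⁻ {x} {y} yz x[yz] xy [xy]z c m with ∈sum⁻ [xy]z m
  ... | e , e∈ , k with ∈sum⁻ xy k
  ...   | f , f∈ , n = ∈sum⁺ x[yz] (f ⊕ e) (∈sum⁺ yz e e∈ (down y (⊕⊖≤ f e) f∈))
    (down x (≤-reflexive (trans (⊖-cong refl (comm f e)) (sym (⊖⊖≈⊖⊕ c e f)))) n)

  -- If `c` is outside `x`, then `~ c` is in `~ᴵ x`, so the hypothesis puts `~ c ⊕ b` into `~ᴵ z`.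
  -- Its negation is `c ⊖ b` by definition, which is thus outside `z`.
  sum-swap⁺ : ∀ {x y z} (p : y ⊑ ~ᴵ ~ᴵ x) (q : y ⊑ ~ᴵ z) → sum (~ᴵ x) y p ⊑ ~ᴵ z → sum z y q ⊑ x
  sum-swap⁺ {x} p q le c m with ∈sum⁻ q m
  ... | b , b∈ , n = stable λ c∉x → ∈~⁻ (le (~ c ⊕ b) (⊕∈sum p
    (∈~⁺ λ k → c∉x (down x (≤-reflexive (sym (~-involutive c))) k)) b∈)) n

  sum-swap⁻ : ∀ {x y z} (p : y ⊑ ~ᴵ ~ᴵ x) (q : y ⊑ ~ᴵ z) → sum z y q ⊑ x → sum (~ᴵ x) y p ⊑ ~ᴵ z
  sum-swap⁻ {x} p q le c m with ∈sum⁻ p m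
  ... | b , b∈ , n = ∈~⁺ λ ~c∈z →
    ∈~⁻ n (down x (≤-reflexive (~-involutive _)) (le (~ c ⊕ b) (⊕∈sum q ~c∈z b∈)))

  -- Subtracting `b′` from `c ⊕ b′` returns only `~ b′ ∧ c`, and primality yields `c` once `~ b′` is
  -- outside `x`. The domain of `star` provides `b₀` outside `y` with `~ b₀` outside `x`, so `b′` is
  -- taken to be `b ∧ b₀`.
  star-reflect : ∀ {x y z w} (p : ¬ ~ᴵ x ⊑ y) → ¬ w ⊑ y → (q : w ⊑ ~ᴵ z) →
                 sum z w q ⊑ star x y p → z ⊑ x
  star-reflect {x} {y} {z} {w} p w⋢y q le c c∈z with ⋢⇒∈∉ w y w⋢y | ⋢⇒∈∉ (~ᴵ x) y p
  ... | b , b∈w , b∉y | b₀ , b₀∈ix , b₀∉y = stable λ c∉x →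
    ∧∉ x (λ ~b′∈x → ∈~⁻ b₀∈ix (down x (~-antitone (x∧y≤y b b₀)) ~b′∈x)) c∉x
       (down x (≤-reflexive (~y∧x≈x⊕y⊖y c (b ∧ b₀)))
         (∈star⁻ p (le (c ⊕ (b ∧ b₀)) (⊕∈sum q c∈z (down w (x∧y≤x b b₀) b∈w))) _ (∧∉ y b∉y b₀∉y)))

  isMVSpace : IsMVSpace ⊖space
  isMVSpace = record
    { i-involutive = ~ᴵ-involutive
    ; +-comm       = λ p q → sum-comm p q , sum-comm q p
    ; +-assoc      = λ yz x[yz] xy [xy]z → sum-assoc⁺ yz x[yz] xy [xy]z , sum-assoc⁻ yz x[yz] xy [xy]z
    ; +-i-swap     = λ p q → mk⇔ (sum-swap⁺ p q) (sum-swap⁻ p q)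
    ; ⋆-reflect    = λ p (w , w⋢y , q , le) → star-reflect p w⋢y q le
    }

-- Homomorphisms of MV-algebras

module MVHomProperties {ℓ} {A B : MVAlgebra ℓ} (h : MVHom A B) where
  private
    module A = MVAlgebra A
    module B = MVAlgebra B
    module AO = MVOrder A
    module BO = MVOrder B
  open MVHom h

  1-homo : ⟦ A.1# ⟧ B.≈ B.1#
  1-homo = B.trans (~-homo A.0#) (B.~-cong ε-homo)

  ⊖-homo : ∀ a b → ⟦ a AO.⊖ b ⟧ B.≈ ⟦ a ⟧ BO.⊖ ⟦ b ⟧
  ⊖-homo a b = B.trans (~-homo _) (B.~-cong (B.trans (homo _ _) (B.∙-congʳ (~-homo a))))

  ∨-homo : ∀ a b → ⟦ a AO.∨ b ⟧ B.≈ ⟦ a ⟧ BO.∨ ⟦ b ⟧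
  ∨-homo a b = B.trans (homo _ _) (B.∙-congʳ (⊖-homo a b))

  ∧-homo : ∀ a b → ⟦ a AO.∧ b ⟧ B.≈ ⟦ a ⟧ BO.∧ ⟦ b ⟧
  ∧-homo a b = B.trans (⊖-homo _ _) (BO.⊖-cong B.refl (⊖-homo a b))

  ≤-homo : ∀ {a b} → a AO.≤ b → ⟦ a ⟧ BO.≤ ⟦ b ⟧
  ≤-homo {a} {b} a≤b = B.trans (B.∙-congʳ (B.sym (~-homo a)))
    (B.trans (B.sym (homo _ _)) (B.trans (⟦⟧-cong a≤b) 1-homo))

module InverseHom {ℓ} {A B : MVAlgebra ℓ} (h : MVHom A B)
                  (injective : ∀ {a b} → MVAlgebra._≈_ B (MVHom.⟦_⟧ h a) (MVHom.⟦_⟧ h b) →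
                               MVAlgebra._≈_ A a b)
                  (surjective : ∀ b → ∃ λ a → MVAlgebra._≈_ B (MVHom.⟦_⟧ h a) b) where
  private
    module A = MVAlgebra A
    module B = MVAlgebra B
  open MVHom h

  inverse : B.Carrier → A.Carrier
  inverse b = proj₁ (surjective b)

  inverseʳ : ∀ b → ⟦ inverse b ⟧ B.≈ b
  inverseʳ b = proj₂ (surjective b)

  inverseˡ : ∀ a → inverse ⟦ a ⟧ A.≈ a
  inverseˡ a = injective (inverseʳ ⟦ a ⟧)

  inverseHom : MVHom B A
  inverseHom = record
    { ⟦_⟧ = inverse
    ; isMonoidHomomorphism = record
      { isMagmaHomomorphism = record
        { isRelHomomorphism = record
          { cong = λ b≈c → injective (B.trans (inverseʳ _) (B.trans b≈c (B.sym (inverseʳ _)))) }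
        ; homo = λ b c → injective (B.trans (inverseʳ _) (B.sym
            (B.trans (homo _ _) (B.∙-cong (inverseʳ b) (inverseʳ c))))) }
      ; ε-homo = injective (B.trans (inverseʳ _) (B.sym ε-homo)) }
    ; ~-homo = λ b → injective (B.trans (inverseʳ _) (B.sym
        (B.trans (~-homo _) (B.~-cong (inverseʳ b)))))
    }

-- The map of spectra induced by a homomorphism

module SpectrumMap (ax : Axioms)
                   {ℓ} {A B : MVAlgebra ℓ} (h : MVHom A B) where
  private
    module A = MVAlgebra A
    module B = MVAlgebra B
    module AO = MVOrder A
    module BO = MVOrder B
    module XA = Spectrum ax A
    module XB = Spectrum ax B
    module IA = PrimeIdeals ax A
  open Classical ax ℓ
  open PrimeIdeals ax B
  open MVHom h
  open MVHomProperties h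

  preimage : PrimeIdeal → IA.PrimeIdeal
  preimage x = record
    { member = λ a → PrimeIdeal.member x ⟦ a ⟧
    ; isPrimeIdeal = record
      { 0∈    = down x (BO.≤-reflexive ε-homo) (0∈ x)
      ; 1∉    = up x (BO.≤-reflexive (B.sym 1-homo)) (1∉ x)
      ; down  = λ a≤b → down x (≤-homo a≤b)
      ; ∨∈    = λ m n → down x (BO.≤-reflexive (∨-homo _ _)) (∨∈ x m n)
      ; prime = λ m → prime x (down x (BO.≤-reflexive (B.sym (∧-homo _ _))) m)
      } }

  ⊖∈ : ∀ x {a b} → (a AO.⊖ b) IA.∈ᴵ preimage x → ⟦ a ⟧ BO.⊖ ⟦ b ⟧ ∈ᴵ x
  ⊖∈ x = down x (BO.≤-reflexive (B.sym (⊖-homo _ _)))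

  ⊖∉ : ∀ x {a b} → (a AO.⊖ b) IA.∉ᴵ preimage x → ⟦ a ⟧ BO.⊖ ⟦ b ⟧ ∉ᴵ x
  ⊖∉ x = up x (BO.≤-reflexive (⊖-homo _ _))

  preimage-~ : ∀ x → preimage (~ᴵ x) XA.≋ IA.~ᴵ (preimage x)
  preimage-~ x =
    (λ a m → IA.∈~⁺ {preimage x} (up x (BO.≤-reflexive (B.sym (~-homo a))) (∈~⁻ m))) ,
    (λ a m → ∈~⁺ (up x (BO.≤-reflexive (~-homo a)) (IA.∈~⁻ {preimage x} m)))

  -- The set `C` is the image of the complement of the given sum. The residual `w` is the largest
  -- ideal whose sum with `x` misses `C`, which forces the preimage of that sum into the given one.
  module Lifting x z (q : z IA.⊑ IA.~ᴵ preimage x) where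
    C : Pred B.Carrier ℓ
    C d = ∃ λ c → c IA.∉ᴵ IA.sum (preimage x) z q × d ≡ ⟦ c ⟧

    C-inhabited : ∃ C
    C-inhabited = _ , A.1# , IA.1∉ (IA.sum (preimage x) z q) , ≡-refl

    C-disjoint : ∀ d → d ∈ C → d ∉ᴵ x
    C-disjoint _ (c , c∉ , ≡-refl) m = c∉ (XA.x⊑sum q c m)

    w : PrimeIdeal
    w = residual C x C-inhabited C-disjoint

    w⊑ : w ⊑ ~ᴵ x
    w⊑ = residual-dom C x C-inhabited C-disjoint

    z⊑ : z IA.⊑ preimage w
    z⊑ b b∈z = ∈residual⁺ λ { _ (c , c∉ , ≡-refl) → ⊖∉ x λ m → c∉ (IA.∈sum⁺ q b b∈z m) }

    sum≋ : preimage (sum x w w⊑) XA.≋ IA.sum (preimage x) z q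
    sum≋ =
      (λ c m → stable λ c∉ → let d , d∈ , n = ∈sum⁻ w⊑ m in ∈residual⁻ d∈ ⟦ c ⟧ (c , c∉ , ≡-refl) n) ,
      (λ c m → let b , b∈ , n = IA.∈sum⁻ q m in ∈sum⁺ w⊑ ⟦ b ⟧ (z⊑ b b∈) (⊖∈ x n))

  spectrumMap : ⊖Hom XB.⊖space XA.⊖space
  spectrumMap = record
    { func       = record
      { to   = preimage
      ; cong = λ (p , q) → (λ a → p ⟦ a ⟧) , (λ a → q ⟦ a ⟧) }
    ; continuous = λ o x u → let a , b , a∈ , b∉ , sub = o (preimage x) u in
                   ⟦ a ⟧ , ⟦ b ⟧ , a∈ , b∉ , sub
    ; mono       = λ p a → p ⟦ a ⟧
    ; i-homo     = preimage-~
    ; +-lax      = λ {x} p c m → let b , b∈ , n = IA.∈sum⁻ _ m in ∈sum⁺ p ⟦ b ⟧ b∈ (⊖∈ x n)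
    ; +-lift     = λ {x} {z} q → let open Lifting x z q in w , w⊑ , z⊑ , sum≋
    }

-- The homomorphism induced by a morphism of MV-spaces

module ClopenMap (ax : Axioms) {ℓ} {X Y : ⊖Space ℓ}
                 (mvX : IsMVSpace X) (mvY : IsMVSpace Y) (f : ⊖Hom X Y) where
  private
    module X = ⊖Space X
    module Y = ⊖Space Y
    module CX = ClopenDownSets ax X mvX
    module CY = ClopenDownSets ax Y mvY
    module PX = PriestleyProperties ax X.space
    module DX = ⊖SpaceProperties ax X
    module DY = ⊖SpaceProperties ax Y
  open Classical ax ℓ
  open PriestleyProperties ax Y.space
  open ⊖Hom f

  preimage : ClopenDownSet → PX.ClopenDownSet
  preimage U = record
    { member   = λ x → ClopenDownSet.member U ⟦ x ⟧
    ; isClopen = continuous (isOpen U) , continuous (∁-isOpen U)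
    ; isDown   = λ x≤y → isDown U (mono x≤y)
    }

  preimage-cong : ∀ {U V} → U CY.≈ᶜ V → preimage U CX.≈ᶜ preimage V
  preimage-cong p = record { to = CY._≈ᶜ_.to p ; from = CY._≈ᶜ_.from p }

  preimage-~ : ∀ U → preimage (DY.~ᶜ U) CX.≈ᶜ DX.~ᶜ (preimage U)
  preimage-~ U = record
    { to   = λ m → ⌊⌋⁺ λ n → ⌊⌋⁻ m (isDown U (Y.reflexive (Y.Eq.sym (i-homo _))) n)
    ; from = λ m → ⌊⌋⁺ λ n → ⌊⌋⁻ m (isDown U (Y.reflexive (i-homo _)) n) }

  preimage-⊕ : ∀ U V → preimage (U CY.⊕ᶜ V) CX.≈ᶜ preimage U CX.⊕ᶜ preimage V
  preimage-⊕ U V = CX.∌⇒≈ᶜ (preimage (U CY.⊕ᶜ V)) (preimage U CX.⊕ᶜ preimage V) to from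
    where
    to : ∀ {x} → U CY.⊕ᶜ V ∌ ⟦ x ⟧ → preimage U CX.⊕ᶜ preimage V PX.∌ x
    to {x} n with CY.∌⊕⁻ U V n
    ... | y , z , p , y∉U , z∉V , y+z≤fx with lift-sum
      where
      q : (⟦ X.i x ⟧ , z) ∈ Y.dom+
      q = Y.trans (CY.+-increasingʳ p) (Y.trans y+z≤fx (Y.trans CY.≤ii (Y.i-antitone (Y.reflexive (i-homo x)))))
      iy : (Y.i ⟦ x ⟧ , z) ∈ Y.dom+
      iy = Y.trans (CY.+-increasingʳ p) (Y.trans y+z≤fx CY.≤ii)
      lift-sum : ∃ λ w → Σ[ r ∈ (X.i x , w) ∈ X.dom+ ] z Y.≤ ⟦ w ⟧ × ⟦ X.i x X.+ w [ r ] ⟧ Y.≤ Y.i y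
      lift-sum with +-lift q
      ... | w , r , z≤fw , eq = w , r , z≤fw , Y.trans (Y.reflexive eq)
        (Y.trans (Y.+-monoˡ q iy (Y.reflexive (i-homo x))) (CY.+-swap⁻ iy p y+z≤fx))
    ...   | w , r , z≤fw , le = CX.∌⊕⁺ (preimage U) (preimage V)
      (X.i (X.i x X.+ w [ r ]) , w , dom , isUp-∁ U y≤ y∉U , isUp-∁ V z≤fw z∉V , CX.+-swap⁺ r dom CX.≤ii)
      where
      dom : (X.i (X.i x X.+ w [ r ]) , w) ∈ X.dom+
      dom = X.trans (CX.+-increasingʳ r) CX.≤ii
      y≤ : y Y.≤ ⟦ X.i (X.i x X.+ w [ r ]) ⟧
      y≤ = Y.trans CY.≤ii (Y.trans (Y.i-antitone le) (Y.reflexive (Y.Eq.sym (i-homo _))))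
    from : ∀ {x} → preimage U CX.⊕ᶜ preimage V PX.∌ x → U CY.⊕ᶜ V ∌ ⟦ x ⟧
    from n with CX.∌⊕⁻ (preimage U) (preimage V) n
    ... | y , z , p , y∉ , z∉ , le =
      CY.∌⊕⁺ U V (⟦ y ⟧ , ⟦ z ⟧ , dom+-preserving p , y∉ , z∉ , Y.trans (+-lax p) (mono le))

  clopenMap : MVHom CY.clopenAlgebra CX.clopenAlgebra
  clopenMap = record
    { ⟦_⟧ = preimage
    ; isMonoidHomomorphism = record
      { isMagmaHomomorphism = record
        { isRelHomomorphism = record { cong = preimage-cong }
        ; homo = preimage-⊕ }
      ; ε-homo = record { to = λ m → contradiction (lower (⌊⌋⁻ m)) λ ()
                        ; from = λ m → contradiction (lower (⌊⌋⁻ m)) λ () } }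
    ; ~-homo = preimage-~
    }

-- Every MV-algebra is the clopen algebra of its spectrum

module AlgebraRepresentation (ax : Axioms)
                             {ℓ} (A : MVAlgebra ℓ) where
  private
    module A = MVAlgebra A
  open MVOrder A
  open Classical ax ℓ
  open PrimeIdeals ax A
  open Spectrum ax A
  open TopologyProperties ax topology
  open PriestleyProperties ax priestleySpace using
    (ClopenDownSet; clopenDownSet; _∋_; isDown; isOpen; ∁-isOpen)
  open ⊖SpaceProperties ax ⊖space using (~ᶜ_; _⊖ᶜ_)
  open ClopenDownSets ax ⊖space isMVSpace

  hat : A.Carrier → ClopenDownSet
  hat a = clopenDownSet (λ x → a ∉ᴵ x) (∉-open a) (∁∉-open a) λ y⊑x n m → n (y⊑x a m)

  hat-cong : ∀ {a b} → a A.≈ b → hat a ≈ᶜ hat b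
  hat-cong a≈b = record
    { to   = λ {x} m → ⌊⌋⁺ (up x (≤-reflexive a≈b) (⌊⌋⁻ m))
    ; from = λ {x} m → ⌊⌋⁺ (up x (≤-reflexive (A.sym a≈b)) (⌊⌋⁻ m)) }

  hat-~ : ∀ a → hat (A.~ a) ≈ᶜ ~ᶜ hat a
  hat-~ a = record
    { to   = λ m → ⌊⌋⁺ λ n → ⌊⌋⁻ n (∈~⁺ (⌊⌋⁻ m))
    ; from = λ m → ⌊⌋⁺ (∈~⁻ (stable λ n → ⌊⌋⁻ m (⌊⌋⁺ n))) }

  hat-⊖ : ∀ a b → hat (a ⊖ b) ≈ᶜ hat a ⊖ᶜ hat b
  hat-⊖ a b = record
    { to   = λ m → let z , p , b∈z , a∉ = difference-witness a b (⌊⌋⁻ m) in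
                   ⌊⌋⁺ (z , p , (λ n → ⌊⌋⁻ n b∈z) , ⌊⌋⁺ a∉)
    ; from = λ m → let z , p , b∌z , n = ⌊⌋⁻ m in
                   ⌊⌋⁺ λ k → ⌊⌋⁻ n (∈sum⁺ p b (stable λ b∉z → b∌z (⌊⌋⁺ b∉z)) k) }

  hat-⊕ : ∀ a b → hat (a A.⊕ b) ≈ᶜ hat a ⊕ᶜ hat b
  hat-⊕ a b = ≈ᶜ-trans (hat-cong (A.sym (~⊖≈⊕ a b))) (≈ᶜ-trans (hat-~ (A.~ a ⊖ b))
    (~-cong (≈ᶜ-trans (hat-⊖ (A.~ a) b) (⊖ᶜ-cong (hat-~ a) ≈ᶜ-refl))))

  hat-0 : hat A.0# ≈ᶜ MVAlgebra.0# clopenAlgebra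
  hat-0 = record { to   = λ {x} m → contradiction (0∈ x) (⌊⌋⁻ m)
                 ; from = λ m → ⊥-elim (lower (⌊⌋⁻ m)) }

  hatHom : MVHom A clopenAlgebra
  hatHom = record
    { ⟦_⟧ = hat
    ; isMonoidHomomorphism = record
      { isMagmaHomomorphism = record
        { isRelHomomorphism = record { cong = hat-cong }
        ; homo = hat-⊕ }
      ; ε-homo = hat-0 }
    ; ~-homo = hat-~
    }

  hat-injective : ∀ {a b} → hat a ≈ᶜ hat b → a A.≈ b
  hat-injective {a} {b} p = ≤-antisym (reflect λ x → _≈ᶜ_.to p {x}) (reflect λ x → _≈ᶜ_.from p {x})
    where
    reflect : ∀ {a b} → (∀ x → hat a ∋ x → hat b ∋ x) → a ≤ b
    reflect h = stable λ a≰b → let x , b∈x , a∉x = prime-ideal-theorem a≰b in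
      ⌊⌋⁻ (h x (⌊⌋⁺ a∉x)) b∈x

  -- A clopen down-set is compact, hence a finite union of sets `hat c`, and the join of these `c`
  -- represents it.
  hat-surjective : ∀ U → ∃ λ a → hat a ≈ᶜ U
  hat-surjective U =
    let is , cover = closed-compact spectrum-compact {C = U ∋_} (∁-isOpen U) (λ i x → c i ∉ᴵ x)
          (λ i → ∉-open (c i)) (λ {x} x∈U → (x , x∈U) , proj₁ (proj₂ (nbhd (x , x∈U))))
        a , a⊆U , ⊆a = joins is
    in a , record { to = λ {x} m → a⊆U x (⌊⌋⁻ m) ; from = λ {x} m → ⌊⌋⁺ (⊆a x (cover m)) }
    where
    nbhd : ((x , _) : ∃ (U ∋_)) → ∃ λ c → c ∉ᴵ x × (∀ {z} → c ∉ᴵ z → U ∋ z)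
    nbhd (x , x∈U) = shrink-∉ (isOpen U) (isDown U) x∈U
    c : ∃ (U ∋_) → A.Carrier
    c i = proj₁ (nbhd i)
    joins : ∀ is → ∃ λ a → (∀ x → a ∉ᴵ x → U ∋ x) × (∀ x → Any (λ i → c i ∉ᴵ x) is → a ∉ᴵ x)
    joins [] = A.0# , (λ x n → contradiction (0∈ x) n) , λ _ ()
    joins (i ∷ is) with joins is
    ... | a , a⊆U , ⊆a = c i ∨ a ,
      (λ x n → [ proj₂ (proj₂ (nbhd i)) , a⊆U x ]′ (neither λ p q → ⊥-elim (n (∨∈ x (stable p) (stable q))))) ,
      (λ { x (here n) → up x (x≤x∨y _ _) n ; x (there m) → up x (y≤x∨y _ _) (⊆a x m) })

  open InverseHom hatHom hat-injective hat-surjective public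

-- Every MV-space is the spectrum of its clopen algebra

module SpaceRepresentation (ax : Axioms)
                           {ℓ} (X : ⊖Space ℓ) (mv : IsMVSpace X) where
  open ⊖Space X hiding (L)
  open Classical ax ℓ
  open TopologyProperties ax τ using (locally-open)
  open PriestleyProperties ax space using
    (_∋_; _∌_; isOpen; ∁-isOpen; isUp-∁; separate; shrink-up; shrink-clopen)
  open ⊖SpaceProperties ax X using (~ᶜ_)
  open ClopenDownSets ax X mv
  open MVOrder (ClopenDownSets.clopenAlgebra ax X mv) using (_⊖_; _∨_; _∧_; x≤x∨y; y≤x∨y; x∧y≤x; x∧y≤y)
  open PrimeIdeals ax (ClopenDownSets.clopenAlgebra ax X mv)
  open MVAlgebra (ClopenDownSets.clopenAlgebra ax X mv) using (0#; 1#)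
  private
    module S = Spectrum ax (ClopenDownSets.clopenAlgebra ax X mv)
  open S using (_≋_)

  opaque
    point : Carrier → PrimeIdeal
    point x = primeIdeal {I = λ U → U ∌ x} record
      { 0∈    = λ m → lower (⌊⌋⁻ m)
      ; 1∉    = λ n → n (⌊⌋⁺ λ m → lower (⌊⌋⁻ m))
      ; down  = λ {U} {V} U≤V n m → n (≤ᶜ⇒⊆ {U} {V} U≤V m)
      ; ∨∈    = λ {U} {V} u v m → [ u , v ]′ (∋∨⁻ U V m)
      ; prime = λ {U} {V} n → neither λ u v → ⊥-elim (n (∋∧⁺ U V (stable u) (stable v)))
      }

    ∈point⁺ : ∀ U {x} → U ∌ x → U ∈ᴵ point x
    ∈point⁺ U = ⌊⌋⁺

    ∈point⁻ : ∀ U {x} → U ∈ᴵ point x → U ∌ x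
    ∈point⁻ U = ⌊⌋⁻

  ∉point⁺ : ∀ U {x} → U ∋ x → U ∉ᴵ point x
  ∉point⁺ U u m = ∈point⁻ U m u

  ∉point⁻ : ∀ U {x} → U ∉ᴵ point x → U ∋ x
  ∉point⁻ U n = stable λ u → n (∈point⁺ U u)

  point-mono : ∀ {x y} → x ≤ y → point x ⊑ point y
  point-mono x≤y U m = ∈point⁺ U (isUp-∁ U x≤y (∈point⁻ U m))

  point-reflect : ∀ {x y} → point x ⊑ point y → x ≤ y
  point-reflect p = stable λ x≰y → let U , y∈U , x∉U = separate x≰y in
    ∈point⁻ U (p U (∈point⁺ U x∉U)) y∈U

  opaque
    -- If no point induced `I`, each point would lie in some member of `I` or outside some
    -- nonmember. By compactness finitely many sets suffice; the join `V` of the members then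
    -- contains the meet `U` of the nonmembers, although `V` is in `I` and `U` is not.
    point-surjective : ∀ I → ∃ λ x → point x ≋ I
    point-surjective I = stable λ none →
      let is , finite = compact N N-open (cover none)
          U , V , U∉I , V∈I , disjoint = separation is
      in U∉I (down I (⊆⇒≤ᶜ {U} {V} λ {x} u → [ (λ n → contradiction u n) , (λ v → v) ]′ (disjoint x (finite x))) V∈I)
      where
      N : ∃ (_∈ᴵ I) ⊎ ∃ (_∉ᴵ I) → Pred Carrier ℓ
      N (inj₁ (V , _)) x = V ∋ x
      N (inj₂ (U , _)) x = U ∌ x
      N-open : ∀ i → N i ∈ Topology.IsOpen τ
      N-open (inj₁ (V , _)) = isOpen V
      N-open (inj₂ (U , _)) = ∁-isOpen U
      cover : ¬ (∃ λ x → point x ≋ I) → ∀ x → ∃ λ i → x ∈ N i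
      cover none x = stable λ uncovered → none (x ,
        (λ U m → stable λ n → uncovered (inj₂ (U , n) , ∈point⁻ U m)) ,
        (λ V m → ∈point⁺ V λ v → uncovered (inj₁ (V , m) , v)))
      separation : ∀ is → ∃₂ λ U V → U ∉ᴵ I × V ∈ᴵ I × (∀ x → Any (λ i → x ∈ N i) is → U ∌ x ⊎ V ∋ x)
      separation [] = 1# , 0# , 1∉ I , 0∈ I , λ _ ()
      separation (inj₁ (W , W∈I) ∷ is) with separation is
      ... | U , V , U∉I , V∈I , h = U , W ∨ V , U∉I , ∨∈ I W∈I V∈I , λ
        { x (here w)  → inj₂ (≤ᶜ⇒⊆ {W} {W ∨ V} (x≤x∨y W V) w)
        ; x (there m) → [ inj₁ , (λ v → inj₂ (≤ᶜ⇒⊆ {V} {W ∨ V} (y≤x∨y W V) v)) ]′ (h x m) }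
      separation (inj₂ (W , W∉I) ∷ is) with separation is
      ... | U , V , U∉I , V∈I , h = W ∧ U , V , ∧∉ I W∉I U∉I , V∈I , λ
        { x (here n)  → inj₁ λ m → n (≤ᶜ⇒⊆ {W ∧ U} {W} (x∧y≤x W U) m)
        ; x (there m) → [ (λ n → inj₁ λ k → n (≤ᶜ⇒⊆ {W ∧ U} {U} (x∧y≤y W U) k)) , inj₂ ]′ (h x m) }

  point-~ : ∀ x → point (i x) ≋ ~ᴵ point x
  point-~ x =
    (λ U m → ∈~⁺ (∉point⁺ (~ᶜ U) (⌊⌋⁺ (∈point⁻ U m)))) ,
    (λ U m → ∈point⁺ U (⌊⌋⁻ (∉point⁻ (~ᶜ U) (∈~⁻ m))))

  point-dom : ∀ {x y} → y ≤ i x → point y ⊑ ~ᴵ point x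
  point-dom {x} p U m = proj₁ (point-~ x) U (point-mono p U m)

  point-dom⁻ : ∀ {x y} → point y ⊑ ~ᴵ point x → y ≤ i x
  point-dom⁻ {x} p = point-reflect λ U m → proj₂ (point-~ x) U (p U m)

  sum⊑point : ∀ {x y} (p : y ≤ i x) q → sum (point x) (point y) q ⊑ point (x + y [ p ])
  sum⊑point {y = y} p q U m with ∈sum⁻ q m
  ... | V , V∈y , k = ∈point⁺ U λ u → ∈point⁻ (U ⊖ V) k
    (_≈ᶜ_.from (⊖≈⊖ᶜ U V) (⌊⌋⁺ (y , p , ∈point⁻ V V∈y , u)))

  -- Upper continuity of + provides the clopen set V witnessing membership in the sum of ideals.
  point⊑sum : ∀ {x y} (p : y ≤ i x) q → point (x + y [ p ]) ⊑ sum (point x) (point y) q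
  point⊑sum {x} {y} p q U m with +-continuous {U ∌_} (∁-isOpen U , isUp-∁ U)
  ... | W , oW , W⊆ , ⊆W with oW (W⊆ {(x , y) , p} (∈point⁻ U m))
  ...   | N , O , _ , (oO , upO) , x∈N , y∈O , sub with shrink-up oO upO y∈O
  ...     | V , y∉V , V⊆O = ∈sum⁺ q V (∈point⁺ V y∉V) (∈point⁺ (U ⊖ V) λ d →
    let z , r , z∉V , u = ⌊⌋⁻ (_≈ᶜ_.to (⊖≈⊖ᶜ U V) d)
    in ⊆W {(x , z) , r} (sub x∈N (V⊆O z∉V)) u)

  unpoint : PrimeIdeal → Carrier
  unpoint I = proj₁ (point-surjective I)

  point⊑ : ∀ I → point (unpoint I) ⊑ I
  point⊑ I = proj₁ (proj₂ (point-surjective I))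

  ⊑point : ∀ I → I ⊑ point (unpoint I)
  ⊑point I = proj₂ (proj₂ (point-surjective I))

  unpoint-mono : ∀ {I J} → I ⊑ J → unpoint I ≤ unpoint J
  unpoint-mono {I} {J} p = point-reflect λ U m → ⊑point J U (p U (point⊑ I U m))

  unpoint-~ : ∀ I → unpoint (~ᴵ I) ≈ i (unpoint I)
  unpoint-~ I = antisym
    (point-reflect λ U m → proj₂ (point-~ x) U (S.~ᴵ-antitone {point x} {I} (point⊑ I) U (point⊑ (~ᴵ I) U m)))
    (point-reflect λ U m → ⊑point (~ᴵ I) U (S.~ᴵ-antitone {I} {point x} (⊑point I) U (proj₁ (point-~ x) U m)))
    where
    x : Carrier
    x = unpoint I

  unpoint-point : ∀ x → unpoint (point x) ≈ x
  unpoint-point x = antisym (point-reflect (point⊑ (point x))) (point-reflect (⊑point (point x)))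

  point-unpoint : ∀ I → point (unpoint I) ≋ I
  point-unpoint I = point⊑ I , ⊑point I

  pointHom : ⊖Hom X (Spectrum.⊖space ax (ClopenDownSets.clopenAlgebra ax X mv))
  pointHom = record
    { func       = record
      { to   = point
      ; cong = λ x≈y → point-mono (reflexive x≈y) , point-mono (reflexive (Eq.sym x≈y)) }
    ; continuous = λ o → locally-open λ {x} u →
        let V , U , V∈ , U∉ , sub = o (point x) u in
        (λ y → V ∌ y × U ∋ y) , ∩-open (∁-isOpen V) (isOpen U) ,
        (∈point⁻ V V∈ , ∉point⁻ U U∉) ,
        λ (v , u) → sub (∈point⁺ V v) (∉point⁺ U u)
    ; mono       = point-mono
    ; i-homo     = point-~
    ; +-lax      = λ p → sum⊑point p _
    ; +-lift     = λ {x} {z} q →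
        let w = unpoint z
            p : w ≤ i x
            p = point-dom⁻ λ U m → q U (point⊑ z U m)
        in w , p , ⊑point z ,
           (λ U m → S.sum-mono {x = point x} (point-dom p) q (λ _ m → m) (point⊑ z) U (point⊑sum p _ U m)) ,
           (λ U m → sum⊑point p _ U (S.sum-mono {x = point x} q (point-dom p) (λ _ m → m) (⊑point z) U m))
    }

  unpoint-+ : ∀ {I J} (p : J ⊑ ~ᴵ I) (q : unpoint J ≤ i (unpoint I)) →
              unpoint (sum I J p) ≈ unpoint I + unpoint J [ q ]
  unpoint-+ {I} {J} p q = antisym
    (point-reflect λ U m → sum⊑point q (point-dom q) U
      (S.sum-mono {I} {J} p (point-dom q) (⊑point I) (⊑point J) U (point⊑ (sum I J p) U m)))
    (point-reflect λ U m → ⊑point (sum I J p) U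
      (S.sum-mono {point (unpoint I)} (point-dom q) p (point⊑ I) (point⊑ J) U (point⊑sum q (point-dom q) U m)))

  unpointHom : ⊖Hom (Spectrum.⊖space ax (ClopenDownSets.clopenAlgebra ax X mv)) X
  unpointHom = record
    { func       = record
      { to   = unpoint
      ; cong = λ (p , q) → antisym (unpoint-mono p) (unpoint-mono q) }
    ; continuous = λ {W} oW I u →
        let U , V , U∋ , V∌ , sub = shrink-clopen oW u in
        V , U , point⊑ I V (∈point⁺ V V∌) , (λ m → ∈point⁻ U (⊑point I U m) U∋) ,
        λ {J} V∈ U∉ → sub (∉point⁻ U λ m → U∉ (point⊑ J U m)) (∈point⁻ V (⊑point J V V∈))
    ; mono       = unpoint-mono
    ; i-homo     = unpoint-~
    ; +-lax      = λ p → reflexive (Eq.sym (unpoint-+ p _))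
    ; +-lift     = λ {I} {z} q →
        let p : point z ⊑ ~ᴵ I
            p = λ U m → S.~ᴵ-antitone {I} (⊑point I) U (point-dom q U m)
            r : unpoint (point z) ≤ i (unpoint I)
            r = trans (reflexive (unpoint-point z)) q
        in point z , p , reflexive (Eq.sym (unpoint-point z)) ,
           Eq.trans (unpoint-+ p r) (Func.cong +-func (Eq.refl , unpoint-point z))
    }

-- The functors and natural isomorphisms of the duality

module Duality (ax : Axioms) (ℓ : Level) where
  spectrum : Functor (MVAlgebras ℓ ᵒᵖ) (MVSpaces ℓ)
  spectrum = record
    { F₀     = λ A → Spectrum.⊖space ax A , Spectrum.isMVSpace ax A
    ; F₁     = λ h → SpectrumMap.spectrumMap ax h
    ; F-cong = λ {A} {B} h≈k x →
        let open PrimeIdeals ax A using (down)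
            open MVOrder A using (≤-reflexive)
            open MVAlgebra A using (sym)
        in (λ b → down x (≤-reflexive (sym (h≈k b)))) , (λ b → down x (≤-reflexive (h≈k b)))
    ; F-id   = λ _ → (λ _ m → m) , (λ _ m → m)
    ; F-∙    = λ _ _ _ → (λ _ m → m) , (λ _ m → m)
    }

  clopens : Functor (MVSpaces ℓ) (MVAlgebras ℓ ᵒᵖ)
  clopens = record
    { F₀     = λ (X , mv) → ClopenDownSets.clopenAlgebra ax X mv
    ; F₁     = λ { {_ , mvX} {_ , mvY} f → ClopenMap.clopenMap ax mvX mvY f }
    ; F-cong = λ { {X , mvX} {Y , mvY} f≈g U →
        let open ⊖Space Y using (reflexive; module Eq)
            open PriestleyProperties ax (⊖Space.space Y) using (isDown)
        in record { to   = λ {x} → isDown U (reflexive (Eq.sym (f≈g x)))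
                  ; from = λ {x} → isDown U (reflexive (f≈g x)) } }
    ; F-id   = λ _ → record { to = λ m → m ; from = λ m → m }
    ; F-∙    = λ _ _ _ → record { to = λ m → m ; from = λ m → m }
    }

  unit : NaturalIsomorphism (idF (MVAlgebras ℓ ᵒᵖ)) (clopens ∘F spectrum)
  unit = record
    -- In the opposite category the component at `A` is a homomorphism into `A`, so it is the
    -- inverse of `hat`.
    { η       = λ A → AlgebraRepresentation.inverseHom ax A
    ; natural = λ {A} {B} h u →
        let module A = AlgebraRepresentation ax A
            module B = AlgebraRepresentation ax B
            module GA = MVAlgebra (ClopenDownSets.clopenAlgebra ax (Spectrum.⊖space ax A) (Spectrum.isMVSpace ax A))
            module Gh = MVHom (Functor.F₁ (clopens ∘F spectrum) {A} {B} h)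
        -- Applying the injective `hat` reduces the square for the inverses to `hat-natural`.
        in A.hat-injective (GA.trans (hat-natural h (B.inverse u))
             (GA.trans (Gh.⟦⟧-cong (B.inverseʳ u)) (GA.sym (A.inverseʳ (Gh.⟦ u ⟧)))))
    ; η⁻¹     = λ A → AlgebraRepresentation.hatHom ax A
    ; isoˡ    = λ A → AlgebraRepresentation.inverseˡ ax A
    ; isoʳ    = λ A → AlgebraRepresentation.inverseʳ ax A
    }
    where
    hat-natural : ∀ {A B} (h : MVHom B A) b →
      let open ClopenDownSets ax (Spectrum.⊖space ax A) (Spectrum.isMVSpace ax A) using (_≈ᶜ_) in
      AlgebraRepresentation.hat ax A (MVHom.⟦_⟧ h b) ≈ᶜ
      MVHom.⟦_⟧ (Functor.F₁ (clopens ∘F spectrum) {A} {B} h) (AlgebraRepresentation.hat ax B b)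
    hat-natural h b = record { to = λ m → ⌊⌋⁺ (⌊⌋⁻ m) ; from = λ m → ⌊⌋⁺ (⌊⌋⁻ m) }
      where open Classical ax ℓ

  module _ {X Y : ⊖Space ℓ} (mvX : IsMVSpace X) (mvY : IsMVSpace Y) (f : ⊖Hom X Y) where
    private
      module SX = SpaceRepresentation ax X mvX
      module SY = SpaceRepresentation ax Y mvY
      module Y = ⊖Space Y
      h = ClopenMap.clopenMap ax mvX mvY f
      open ClopenMap ax mvX mvY f using (preimage)

    unpoint-natural : ∀ I → SY.unpoint (SpectrumMap.preimage ax h I) Y.≈ ⊖Hom.⟦_⟧ f (SX.unpoint I)
    unpoint-natural I = Y.antisym
      (SY.point-reflect λ U m → SY.∈point⁺ U
        (SX.∈point⁻ (preimage U) (SX.⊑point I (preimage U) (SY.point⊑ J U m))))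
      (SY.point-reflect λ U m → SY.⊑point J U
        (SX.point⊑ I (preimage U) (SX.∈point⁺ (preimage U) (SY.∈point⁻ U m))))
      where J = SpectrumMap.preimage ax h I

  counit : NaturalIsomorphism (spectrum ∘F clopens) (idF (MVSpaces ℓ))
  counit = record
    { η       = λ (X , mv) → SpaceRepresentation.unpointHom ax X mv
    ; natural = λ { {_ , mvX} {_ , mvY} → unpoint-natural mvX mvY }
    ; η⁻¹     = λ (X , mv) → SpaceRepresentation.pointHom ax X mv
    ; isoˡ    = λ (X , mv) → SpaceRepresentation.point-unpoint ax X mv
    ; isoʳ    = λ (X , mv) → SpaceRepresentation.unpoint-point ax X mv
    }

corollary4p5 : (∀ {a} → ExcludedMiddle a) → (∀ {a b} → Extensionality a b) →
    ∀ ℓ → DuallyEquivalent (MVAlgebras ℓ) (MVSpaces ℓ)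
corollary4p5 em ext ℓ = record { F = spectrum ; G = clopens ; unit = unit ; counit = counit }
  where open Duality (axioms em ext) ℓ
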